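{- Let $X$ be a definable set in the ordered Fraenkel–Mostowski model $\mathbf{ZFA}(\mathcal{Q})$ of set theory with atoms. Then for any field $\mathcal{K}$ (without atoms) the vector space $\mathcal{K}^X$ has a definable basis.
   Context: $\mathcal{Q}=\langle\mathbb{Q},\le\rangle$ is the rationals with their natural order; its automorphisms are the order-preserving bijections. $\mathbf{ZFA}(\mathcal{Q})$ is the permutation model with atoms $\mathbb{Q}$ consisting of hereditarily finitely supported sets (a set is supported by finite $A_0\subseteq\mathbb{Q}$ if fixed by all automorphisms fixing $A_0$ pointwise). A set is definable if for some finite $A_0$ it is supported by $A_0$ and has finitely many orbits under automorphisms fixing $A_0$ pointwise. $\mathcal{K}^X$ is the vector space of finitely supported functions $X\to\mathcal{K}$. -}

module Defs where

open import Level using (Level; Lift; lift; _⊔_; suc)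
open import Algebra.Bundles using (CommutativeRing)
open import Algebra.Module.Bundles using (Module)
open import Algebra.Module.Structures.Biased using (IsModuleFromLeft)
import Algebra.Properties.CommutativeMonoid.Sum as Sum
open import Data.Empty.Polymorphic using (⊥)
open import Data.Fin.Base using (Fin)
open import Data.List.Base using (List; []; _∷_; _++_)
open import Data.List.Relation.Unary.All using (All; []; _∷_)
open import Data.List.Relation.Unary.All.Properties using (++⁻ˡ; ++⁻ʳ)
open import Data.List.Relation.Unary.Any using (Any)
open import Data.Product.Base using (∃; ∃-syntax; _×_; _,_; proj₁; proj₂)
open import Data.Rational.Base using (ℚ; _≤_)
open import Data.Vec.Functional using (Vector)
open import Function.Bundles using (Func)
open import Relation.Binary.Bundles using (Setoid)
open import Relation.Binary.Core using (Rel)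
open import Relation.Binary.Definitions using (_Respects_)
open import Relation.Binary.Morphism.Structures using (IsOrderIsomorphism)
open import Relation.Binary.PropositionalEquality.Core as ≡ using (_≡_)
open import Relation.Nullary.Negation.Core using (¬_)
open import Relation.Unary using (Pred)

private
  variable
    c ℓ e m p r t : Level

------------------------------------------------------------------------
-- Automorphisms of ⟨ℚ, ≤⟩

record Aut : Set where
  field
    to                 : ℚ → ℚ
    isOrderIsomorphism : IsOrderIsomorphism _≡_ _≡_ _≤_ _≤_ to

Fixes : Aut → List ℚ → Set
Fixes π A = All (λ q → Aut.to π q ≡ q) A

------------------------------------------------------------------------
-- Sets with atoms

-- The cumulative hierarchy over the atoms ℚ, after Aczel: set f is the
-- set { f i ∣ i ∈ I }, and _≈_ is extensional equality.

data V (ℓ : Level) : Set (suc ℓ) where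
  atom : ℚ → V ℓ
  set  : {I : Set ℓ} → (I → V ℓ) → V ℓ

infix 4 _≈_ _∈_

_≈_ : V ℓ → V ℓ → Set ℓ
_≈_ {ℓ} (atom p) (atom q) = Lift ℓ (p ≡ q)
atom _ ≈ set _  = ⊥
set _  ≈ atom _ = ⊥
set f  ≈ set g  = (∀ i → ∃[ j ] f i ≈ g j) × (∀ j → ∃[ i ] f i ≈ g j)

≈-refl : (x : V ℓ) → x ≈ x
≈-refl (atom q) = lift ≡.refl
≈-refl (set f)  = (λ i → i , ≈-refl (f i)) , (λ i → i , ≈-refl (f i))

≈-sym : (x y : V ℓ) → x ≈ y → y ≈ x
≈-sym (atom _) (atom _) (lift eq) = lift (≡.sym eq)
≈-sym (set f)  (set g)  (h , k)   =
  (λ j → let i , u = k j in i , ≈-sym (f i) (g j) u) ,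
  (λ i → let j , u = h i in j , ≈-sym (f i) (g j) u)

≈-trans : (x y z : V ℓ) → x ≈ y → y ≈ z → x ≈ z
≈-trans (atom _) (atom _) (atom _) (lift eq) (lift eq′) = lift (≡.trans eq eq′)
≈-trans (set f)  (set g)  (set h)  (s , t)   (s′ , t′)  =
  (λ i → let j , u = s i ; l , v = s′ j
         in l , ≈-trans (f i) (g j) (h l) u v) ,
  (λ l → let j , v = t′ l ; i , u = t j
         in i , ≈-trans (f i) (g j) (h l) u v)

data IsSet {ℓ} : V ℓ → Set (suc ℓ) where
  set : ∀ {I} {f : I → V ℓ} → IsSet (set f)

Index : V ℓ → Set ℓ
Index (atom _)    = ⊥
Index (set {I} _) = I

element : (X : V ℓ) → Index X → V ℓ
element (set f) i = f i

_∈_ : V ℓ → V ℓ → Set ℓ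
x ∈ X = ∃[ i ] x ≈ element X i

-- The members of X, with indices of equal members identified.

Elements : V ℓ → Setoid ℓ ℓ
Elements X = record
  { Carrier       = Index X
  ; _≈_           = λ i j → element X i ≈ element X j
  ; isEquivalence = record
    { refl  = ≈-refl _
    ; sym   = ≈-sym _ _
    ; trans = ≈-trans _ _ _
    }
  }

infixr 8 _·_

_·_ : Aut → V ℓ → V ℓ
π · atom q = atom (Aut.to π q)
π · set f  = set (λ i → π · f i)

Supports : List ℚ → V ℓ → Set ℓ
Supports A x = ∀ π → Fixes π A → π · x ≈ x

FinitelySupported : V ℓ → Set ℓ
FinitelySupported x = ∃[ A ] Supports A x

data HereditarilyFinitelySupported {ℓ} : V ℓ → Set (suc ℓ) where
  atom : ∀ q → HereditarilyFinitelySupported (atom q)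
  set  : ∀ {I} {f : I → V ℓ} → FinitelySupported (set f) →
         (∀ i → HereditarilyFinitelySupported (f i)) →
         HereditarilyFinitelySupported (set f)

finitelySupported : {x : V ℓ} → HereditarilyFinitelySupported x →
                    FinitelySupported x
finitelySupported (atom q)  = q ∷ [] , λ { π (fix ∷ []) → lift fix }
finitelySupported (set s _) = s

record ZFAℚ (ℓ : Level) : Set (suc ℓ) where
  constructor _,_
  field
    value      : V ℓ
    hereditary : HereditarilyFinitelySupported value

------------------------------------------------------------------------
-- Definability

-- T π x y reads "π · x = y".  It is a relation because a translate of a
-- function on X is in general a function on a different set, π · X.

module _ {C : Set c} (T : Aut → Rel C t) where

  SupportsSubset : List ℚ → Pred C p → Set (c ⊔ t ⊔ p)
  SupportsSubset A P = ∀ π → Fixes π A →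
    (∀ x → P x → ∃[ y ] P y × T π x y) ×
    (∀ y → P y → ∃[ x ] P x × T π x y)

  FinitelyManyOrbits : List ℚ → Pred C p → Set (c ⊔ t ⊔ p)
  FinitelyManyOrbits A P = ∃[ xs ] All P xs ×
    (∀ y → P y → Any (λ x → ∃[ π ] Fixes π A × T π x y) xs)

  DefinableSubset : Pred C p → Set (c ⊔ t ⊔ p)
  DefinableSubset P = ∃[ A ] SupportsSubset A P × FinitelyManyOrbits A P

Definable : V ℓ → Set (suc ℓ)
Definable X = IsSet X × DefinableSubset (λ π x y → π · x ≈ y) (_∈ X)

------------------------------------------------------------------------
-- Fields and bases

record Field c e : Set (suc (c ⊔ e)) where
  field
    commutativeRing : CommutativeRing c e

  open CommutativeRing commutativeRing public
    renaming (_≈_ to _≈ᴷ_)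

  field
    1≉0     : ¬ 1# ≈ᴷ 0#
    inverse : ∀ x → ¬ x ≈ᴷ 0# → ∃[ y ] x * y ≈ᴷ 1#

module _ {R : CommutativeRing r e} (M : Module R m ℓ) where
  open CommutativeRing R using (Carrier; 0#) renaming (_≈_ to _≈ᴿ_)
  open Module M
  open Sum +ᴹ-commutativeMonoid using (sum)

  combination : ∀ {n} → Vector Carrier n → Vector Carrierᴹ n → Carrierᴹ
  combination k b = sum (λ i → k i *ₗ b i)

  LinearlyIndependent : Pred Carrierᴹ p → Set (r ⊔ e ⊔ m ⊔ ℓ ⊔ p)
  LinearlyIndependent B =
    ∀ n (k : Vector Carrier n) (b : Vector Carrierᴹ n) →
    (∀ i → B (b i)) → (∀ i j → b i ≈ᴹ b j → i ≡ j) →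
    combination k b ≈ᴹ 0ᴹ → ∀ i → k i ≈ᴿ 0#

  Spans : Pred Carrierᴹ p → Set (r ⊔ m ⊔ ℓ ⊔ p)
  Spans B = ∀ v → ∃[ n ] ∃[ k ] ∃[ b ]
    (∀ (i : Fin n) → B (b i)) × v ≈ᴹ combination k b

  record IsBasis (B : Pred Carrierᴹ p) : Set (r ⊔ e ⊔ m ⊔ ℓ ⊔ p) where
    field
      respects            : B Respects _≈ᴹ_
      linearlyIndependent : LinearlyIndependent B
      spans               : Spans B

------------------------------------------------------------------------
-- The space of finitely supported functions

-- A field without atoms is an ordinary field K, on which automorphisms
-- act trivially.  A function f on X is the set of pairs (x , f x), so
-- π · f is the set of pairs (π · x , f x); it equals g : X → K iff
-- π · X = X and g (π · x) = f x for every x ∈ X.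

module _ (K : Field c e) where
  private module K = Field K

  Translate : (X : V ℓ) → Aut → Rel (Func (Elements X) K.setoid) (ℓ ⊔ e)
  Translate X π f g = π · X ≈ X ×
    (∀ i j → π · element X i ≈ element X j →
       Func.to f i K.≈ᴷ Func.to g j)

  record FinSuppFunc (X : V ℓ) : Set (ℓ ⊔ c ⊔ e) where
    field
      func    : Func (Elements X) K.setoid
      support : ∃[ A ] (∀ π → Fixes π A → Translate X π func func)

    open Func func public

  TranslateFS : (X : V ℓ) → Aut → Rel (FinSuppFunc X) (ℓ ⊔ e)
  TranslateFS X π f g =
    Translate X π (FinSuppFunc.func f) (FinSuppFunc.func g)

  infix 8 _^_

  _^_ : ZFAℚ ℓ → Module K.commutativeRing (ℓ ⊔ c ⊔ e) (ℓ ⊔ e)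
  _^_ (X , hfs) = record
    { Carrierᴹ = FinSuppFunc X
    ; _≈ᴹ_     = λ f g → ∀ i → to f i K.≈ᴷ to g i
    ; _+ᴹ_     = λ f g → record
      { func    = record
        { to   = λ i → to f i K.+ to g i
        ; cong = λ eq → K.+-cong (cong f eq) (cong g eq)
        }
      ; support = proj₁ (support f) ++ proj₁ (support g) , λ π fix →
          let X≈ , f≈ = proj₂ (support f) π (++⁻ˡ _ fix)
              _  , g≈ = proj₂ (support g) π (++⁻ʳ (proj₁ (support f)) fix)
          in X≈ , λ i j eq → K.+-cong (f≈ i j eq) (g≈ i j eq)
      }
    ; _*ₗ_     = scale
    ; _*ᵣ_     = λ f k → scale k f
    ; 0ᴹ       = record
      { func    = record { to = λ _ → K.0# ; cong = λ _ → K.refl }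
      ; support = let A , s = finitelySupported hfs in
          A , λ π fix → s π fix , λ _ _ _ → K.refl
      }
    ; -ᴹ_      = λ f → record
      { func    = record
        { to   = λ i → K.- to f i
        ; cong = λ eq → K.-‿cong (cong f eq)
        }
      ; support = proj₁ (support f) , λ π fix →
          let X≈ , f≈ = proj₂ (support f) π fix
          in X≈ , λ i j eq → K.-‿cong (f≈ i j eq)
      }
    ; isModule = IsModuleFromLeft.isModule {commutativeRing = K.commutativeRing} (record
      { isLeftModule = record
        { isLeftSemimodule = record
          { +ᴹ-isCommutativeMonoid = record
            { isMonoid = record
              { isSemigroup = record
                { isMagma = record
                  { isEquivalence = record
                    { refl  = λ _ → K.refl
                    ; sym   = λ h i → K.sym (h i)
                    ; trans = λ h k i → K.trans (h i) (k i)
                    }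
                  ; ∙-cong = λ h k i → K.+-cong (h i) (k i)
                  }
                ; assoc = λ f g h i → K.+-assoc _ _ _
                }
              ; identity = (λ f i → K.+-identityˡ _) , (λ f i → K.+-identityʳ _)
              }
            ; comm = λ f g i → K.+-comm _ _
            }
          ; isPreleftSemimodule = record
            { *ₗ-cong      = λ h k i → K.*-cong h (k i)
            ; *ₗ-zeroˡ     = λ f i → K.zeroˡ _
            ; *ₗ-distribʳ  = λ f k l i → K.distribʳ _ _ _
            ; *ₗ-identityˡ = λ f i → K.*-identityˡ _
            ; *ₗ-assoc     = λ k l f i → K.*-assoc _ _ _
            ; *ₗ-zeroʳ     = λ k i → K.zeroʳ _
            ; *ₗ-distribˡ  = λ k f g i → K.distribˡ _ _ _
            }
          }
        ; -ᴹ‿cong    = λ h i → K.-‿cong (h i)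
        ; -ᴹ‿inverse = (λ f i → K.-‿inverseˡ _) , (λ f i → K.-‿inverseʳ _)
        }
      })
    }
    where
    open FinSuppFunc

    scale : K.Carrier → FinSuppFunc X → FinSuppFunc X
    scale k f = record
      { func    = record
        { to   = λ i → k K.* to f i
        ; cong = λ eq → K.*-congˡ (cong f eq)
        }
      ; support = proj₁ (support f) , λ π fix →
          let X≈ , f≈ = proj₂ (support f) π fix
          in X≈ , λ i j eq → K.*-congˡ (f≈ i j eq)
      }

{-# OPTIONS --safe #-}

-- Over a finite support A of X, every point x of X has a least support s₁ < … < sₙ
-- outside A, and the automorphisms fixing A and x fix it pointwise.  So each orbit
-- consists of the points π x, with coordinates π sⱼ.  A cell of an orbit prescribes for
-- every coordinate t one of: no condition, t < p, t = p.  Cells are closed under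
-- nonempty intersections, and a finitely supported function depends only on the truth
-- of finitely many conditions, so the indicators of nonempty cells span.
--
-- They are independent because no cell is a finite union of cells that do not contain
-- it: the realisations of a cell are directed under π ⊔ σ, and a coordinate that the
-- cell does not pin to one value has no maximum on it, so above some realisation all
-- those smaller cells are avoided.

module Submission where

open import Defs
open import Level using (_⊔_)
open import Axiom.ExcludedMiddle using (ExcludedMiddle)
open import Data.Product.Base using (Σ-syntax; _×_)
open import Relation.Unary using (Pred)

open import Level using (Level; Lift; lift; lower)
import Algebra.Properties.CommutativeMonoid.Sum as Sum
open import Data.Empty using (⊥; ⊥-elim)
open import Data.Fin.Base using (Fin; zero; suc; punchIn; punchOut)
open import Data.Fin.Induction using (spo-wellFounded)
open import Data.Fin.Properties using (any?; punchIn-punchOut; punchInᵢ≢i) renaming (_≟_ to _≟ᶠ_)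
open import Data.List.Base using (List; []; _∷_; _++_; allFin; concatMap; length; lookup; map; tabulate)
open import Data.List.Membership.Propositional using (lose) renaming (_∈_ to _∈ₗ_)
open import Data.List.Membership.Propositional.Properties
  using (∈-++⁻; ∈-++⁺ˡ; ∈-++⁺ʳ; ∈-allFin; ∈-concatMap⁺; ∈-tabulate⁺; ∈-tabulate⁻)
open import Data.List.Relation.Unary.All as All using (All; []; _∷_)
open import Data.List.Relation.Unary.Any as Any using (Any; here; there; index)
open import Data.List.Relation.Unary.Any.Properties using (++⁺ˡ; ++⁺ʳ; concatMap⁺; lookup-index; map⁺)
open import Data.Nat.Base as ℕ using (ℕ; zero; suc)
open import Data.Nat.Induction using (<-rec)
import Data.Nat.Properties as ℕ
open import Data.Product.Base using (∃; ∃-syntax; _,_; proj₁; proj₂; swap)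
open import Data.Rational.Base as ℚ
  using (ℚ; 0ℚ; 1ℚ; NonNegative; Positive; nonNegative; nonPositive; positive; _≤_; _<_)
open import Data.Rational.Properties as ℚ using
  ( *-identityʳ; *-identityˡ; *-inverseʳ; *-monoʳ-≤-nonNeg; *-monoʳ-≤-nonPos; *-monoˡ-≤-nonNeg
  ; +-identityʳ; +-inverseʳ; +-monoʳ-<; +-monoʳ-≤; +-monoˡ-<; +-monoˡ-≤; 1/pos⇒pos
  ; <-cmp; <-irrefl; <-trans; <-≤-trans; <⇒≤; neg-antimono-≤; negative⁻¹; pos*pos⇒pos
  ; positive⁻¹; pos⇒nonNeg; pos⇒nonZero; p⊓q≤p; p⊓q≤q; p≤p⊔q; p≤q⊔p
  ; p≤q⇒p⊓q≡p; p≤q⇒p⊔q≡q; p≥q⇒p⊓q≡q; p≥q⇒p⊔q≡p; ≤-<-trans; ≤-refl; ≤-total; ≤-trans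
  ; ⊓-idem; ⊓-mono-≤; ⊓-sel; ⊔-mono-≤; ⊔-sel )
import Data.Rational.Solver as ℚ-Solver
open import Data.Sum.Base using (inj₁; inj₂)
open import Data.Unit.Base using (⊤; tt)
open import Data.Vec.Functional as Vector using (Vector; removeAt)
open import Function.Base using (id; _∘_)
open import Induction.WellFounded using (Acc; acc)
open import Relation.Binary.Definitions using (Tri; tri<; tri≈; tri>)
open import Relation.Binary.Morphism.Structures using (IsOrderIsomorphism)
open import Relation.Binary.PropositionalEquality as ≡ using (_≡_; _≢_; refl)
import Relation.Binary.Reasoning.Setoid as SetoidReasoning
open import Relation.Nullary.Decidable.Core using (Dec; yes; no)
open import Relation.Nullary.Negation.Core using (¬_; contradiction)
open import Relation.Unary using (_⊆_; _∩_; ∁)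

-- There is no literal `p < t`: the indicators of `t < p`, `t = p` and `p < t` add up to the
-- indicator of the unconditional cell, so all four cannot be kept. Dropping the upper one leaves
-- `t = p` and two conditions whose ranges have no greatest element, which is what the independence
-- argument needs. The price is that the complement of a cell is in general not a cell. Spanning
-- therefore never restricts a function to a complement: it takes the values outside a condition as
-- valid everywhere and corrects them inside.
--
-- The coordinates of a point have a fixed order among themselves, so literals can contradict each
-- other and different literal vectors can cut out the same cell. Hence the restriction to nonempty
-- cells, and a basis defined as a set of functions rather than as a family indexed by literal
-- vectors.
--
-- Definability comes from the action on parameters: an automorphism fixing A sends a cell to the
-- cell with translated literals, and over A a tuple of finitely many rationals has only finitely
-- many positions up to such automorphisms.

private
  variable
    ℓ : Level

-- Linear algebra of indicator functions

module Indicators {c e i u m} (em : ∀ {a} → ExcludedMiddle a) (K : Field c e)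
                  {I : Set i} {M : Set m} (U : M → Pred I u) where
  private module K = Field K
  open K using (Carrier; 0#; 1#; _+_; _*_; -_; _-_) renaming (_≈ᴷ_ to _≋_)
  open Sum K.+-commutativeMonoid using (sum; sum-remove; sum-cong-≋; sum-replicate-zero)

  IsIndicator : ∀ {p} → Pred I p → (I → Carrier) → Set _
  IsIndicator P f = ∀ x → (P x → f x ≋ 1#) × (¬ P x → f x ≋ 0#)

  GenericPoints : Set _
  GenericPoints = ∀ a → ∃[ x ] U a x → ∀ n (b : Fin n → M) →
    ∃[ x ] U a x × (∀ j → U (b j) x → U a ⊆ U (b j))

  sum-single : ∀ {n} (t : Fin n → Carrier) j → (∀ l → l ≢ j → t l ≋ 0#) → sum t ≋ t j
  sum-single {suc n} t j off = begin
    sum t                     ≈⟨ sum-remove {i = j} t ⟩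
    t j + sum (removeAt t j)  ≈⟨ K.+-congˡ (sum-cong-≋ λ l → off (punchIn j l) (punchInᵢ≢i j l)) ⟩
    t j + sum {n} (λ _ → 0#)  ≈⟨ K.+-congˡ (sum-replicate-zero n) ⟩
    t j + 0#                  ≈⟨ K.+-identityʳ (t j) ⟩
    t j                       ∎
    where open SetoidReasoning K.setoid

  -- By induction along reverse inclusion of the sets: evaluating the relation at a
  -- generic point of U (a j) leaves only the terms whose set contains U (a j).
  indicators-independent : GenericPoints → ∀ n (k : Fin n → Carrier)
    (b : Fin n → I → Carrier) (a : Fin n → M) →
    (∀ j → ∃[ x ] U (a j) x) → (∀ j → IsIndicator (U (a j)) (b j)) →
    (∀ j l → (∀ x → b j x ≋ b l x) → j ≡ l) →
    (∀ x → sum (λ j → k j * b j x) ≋ 0#) → ∀ j → k j ≋ 0#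
  indicators-independent generic n k b a inhabited ind distinct zero-sum j = go (wf j)
    where
    _⊏_ : Fin n → Fin n → Set _
    l ⊏ j = U (a j) ⊆ U (a l) × ¬ (U (a l) ⊆ U (a j))

    wf : ∀ j → Acc _⊏_ j
    wf = spo-wellFounded record
      { isEquivalence = ≡.isEquivalence
      ; irrefl = λ { refl (sub , ¬sub) → ¬sub sub }
      ; trans = λ (s , ¬s) (t , ¬t) → s ∘ t , λ r → ¬s (t ∘ r)
      ; <-resp-≈ = (λ { refl lt → lt }) , (λ { refl lt → lt })
      }

    indicator-unique : ∀ {j l} → U (a j) ⊆ U (a l) → U (a l) ⊆ U (a j) → j ≡ l
    indicator-unique {j} {l} sub sup = distinct j l λ x → by-cases x em
      where
      by-cases : ∀ x → Dec (U (a j) x) → b j x ≋ b l x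
      by-cases x (yes m) = K.trans (proj₁ (ind j x) m) (K.sym (proj₁ (ind l x) (sub m)))
      by-cases x (no ¬m) = K.trans (proj₂ (ind j x) ¬m) (K.sym (proj₂ (ind l x) (¬m ∘ sup)))

    go : ∀ {j} → Acc _⊏_ j → k j ≋ 0#
    go {j} (acc rec) with generic (a j) (inhabited j) n a
    ... | x , x∈ , above = begin
      k j                       ≈⟨ K.sym (K.*-identityʳ (k j)) ⟩
      k j * 1#                  ≈⟨ K.*-congˡ (K.sym (proj₁ (ind j x) x∈)) ⟩
      k j * b j x               ≈⟨ K.sym (sum-single (λ l → k l * b l x) j off) ⟩
      sum (λ l → k l * b l x)   ≈⟨ zero-sum x ⟩
      0#                        ∎
      where
      open SetoidReasoning K.setoid

      off : ∀ l → l ≢ j → k l * b l x ≋ 0#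
      off l l≢j with em {P = U (a l) x}
      ... | no x∉ = K.trans (K.*-congˡ (proj₂ (ind l x) x∉)) (K.zeroʳ (k l))
      -- By genericity of `x`, the set of `l` contains that of `j`. The inclusion is strict, since
      -- equal sets have equal indicators and these are assumed distinct, so the induction gives
      -- `k l ≋ 0#`.
      ... | yes x∈l = K.trans (K.*-congʳ (go (rec (above l x∈l , λ sub →
        l≢j (indicator-unique sub (above l x∈l)))))) (K.zeroˡ (b l x))

  restrict : ∀ {p} → (I → Carrier) → Pred I p → I → Carrier
  restrict h P x with em {P = P x}
  ... | yes _ = h x
  ... | no _  = 0#

  restrict-∈ : ∀ {p} h (P : Pred I p) {x} → P x → restrict h P x ≋ h x
  restrict-∈ h P {x} m with em {P = P x}
  ... | yes _ = K.refl
  ... | no ¬m = contradiction m ¬m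

  restrict-∉ : ∀ {p} h (P : Pred I p) {x} → ¬ P x → restrict h P x ≋ 0#
  restrict-∉ h P {x} ¬m with em {P = P x}
  ... | yes m = contradiction m ¬m
  ... | no _  = K.refl

  -- An intersection needs a code only if it has a point: contradictory literals such as `at p` and
  -- `at q` have no common refinement among the literals.
  module Spanning {t} {T : Set t} (⟦_⟧ : T → I → Carrier)
    (indicator : ∀ a → ∃[ x ] U a x → ∃[ b ] IsIndicator (U a) ⟦ b ⟧)
    (∩-closed : ∀ a b x → U a x → U b x →
      ∃[ d ] (U d ⊆ U a ∩ U b) × (U a ∩ U b ⊆ U d)) where

    -- Only the generators come from `T`. The functions being decomposed are bare maps, so no finite
    -- support has to be maintained for the intermediate pieces.
    data InSpan (h : I → Carrier) : Set (c ⊔ e ⊔ i ⊔ t) where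
      nil  : (∀ x → h x ≋ 0#) → InSpan h
      cons : ∀ k b {g} → InSpan g → (∀ x → h x ≋ k * ⟦ b ⟧ x + g x) → InSpan h

    span-resp : ∀ {g h} → (∀ x → g x ≋ h x) → InSpan g → InSpan h
    span-resp eq (nil z)        = nil λ x → K.trans (K.sym (eq x)) (z x)
    span-resp eq (cons k b s z) = cons k b s λ x → K.trans (K.sym (eq x)) (z x)

    span-+ : ∀ {g h} → InSpan g → InSpan h → InSpan (λ x → g x + h x)
    span-+ (nil z) t = span-resp (λ x → K.sym (K.trans (K.+-congʳ (z x)) (K.+-identityˡ _))) t
    span-+ (cons k b s z) t = cons k b (span-+ s t) λ x →
      K.trans (K.+-congʳ (z x)) (K.+-assoc _ _ _)

    Same : List M → I → I → Set _
    Same αs x y = All (λ α → (U α x → U α y) × (U α y → U α x)) αs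

    same-refl : ∀ αs {x} → Same αs x x
    same-refl αs = All.tabulate λ _ → (λ m → m) , (λ m → m)

    same-sym : ∀ {αs x y} → Same αs x y → Same αs y x
    same-sym = All.map swap

    same-trans : ∀ {αs x y z} → Same αs x y → Same αs y z → Same αs x z
    same-trans s t = All.zipWith (λ ((f , f′) , (g , g′)) → g ∘ f , f′ ∘ g′) (s , t)

    DeterminedOn : ∀ {p} → Pred I p → List M → (I → Carrier) → Set _
    DeterminedOn P αs h = ∀ x y → Same αs x y → P x → P y → h x ≋ h y

    -- Extends the values of `h` on `P` to a function that the conditions `αs` determine on all of
    -- `I`. The default `0#` matters: `saturate-0` relies on it.
    saturate : ∀ {p} → Pred I p → List M → (I → Carrier) → I → Carrier
    saturate P αs h x with em {P = ∃[ y ] Same αs x y × P y}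
    ... | yes (y , _) = h y
    ... | no _        = 0#

    module _ {p} {P : Pred I p} {αs : List M} {h : I → Carrier}
             (det : DeterminedOn P αs h) where

      saturate-≈ : ∀ {x y} → Same αs x y → P y → saturate P αs h x ≋ h y
      saturate-≈ {x} {y} s py with em {P = ∃[ y ] Same αs x y × P y}
      ... | yes (z , t , pz) = det z y (same-trans (same-sym t) s) pz py
      ... | no none          = contradiction (y , s , py) none

      saturate-determined : ∀ x y → Same αs x y → saturate P αs h x ≋ saturate P αs h y
      saturate-determined x y s with em {P = ∃[ z ] Same αs y z × P z}
      ... | yes (z , t , pz) = saturate-≈ (same-trans s t) pz
      ... | no none with em {P = ∃[ z ] Same αs x z × P z}
      ...   | yes (z , t , pz) = contradiction (z , same-trans (same-sym s) t , pz) none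
      ...   | no _             = K.refl

    saturate-0 : ∀ {p} {P : Pred I p} {αs h x} →
                 (∀ {y} → Same αs x y → P y → h y ≋ 0#) → saturate P αs h x ≋ 0#
    saturate-0 {P = P} {αs} {h} {x} vanish with em {P = ∃[ y ] Same αs x y × P y}
    ... | yes (y , s , py) = vanish s py
    ... | no _             = K.refl

    module _ {p} (P : Pred I p) (α : M) (αs : List M) (h : I → Carrier)
             (det : DeterminedOn P (α ∷ αs) h) where

      -- On `P` the function `h` is `inside` where `α` holds and `outside` elsewhere, so it equals
      -- `outside` plus `difference` restricted to `U α`. Both terms depend on `αs` alone, one
      -- condition fewer, and no complement occurs.
      inside outside difference : I → Carrier
      inside  = saturate (P ∩ U α) αs h
      outside = saturate (P ∩ ∁ (U α)) αs h
      difference x = inside x - outside x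

      private
        det-in : DeterminedOn (P ∩ U α) αs h
        det-in x y s (px , ux) (py , uy) =
          det x y (((λ _ → uy) , (λ _ → ux)) ∷ s) px py

        det-out : DeterminedOn (P ∩ ∁ (U α)) αs h
        det-out x y s (px , ux) (py , uy) =
          det x y (((λ u → contradiction u ux) , (λ u → contradiction u uy)) ∷ s) px py

      outside-determined : ∀ x y → Same αs x y → outside x ≋ outside y
      outside-determined = saturate-determined det-out

      difference-determined : ∀ x y → Same αs x y → difference x ≋ difference y
      difference-determined x y s = K.+-cong (saturate-determined det-in x y s)
        (K.-‿cong (outside-determined x y s))

      split : ∀ {q} (Q : Pred I q) → Q ⊆ P ∩ U α → P ∩ U α ⊆ Q →
              ∀ x → P x → h x ≋ restrict difference Q x + outside x
      split Q sub sup x px with em {P = U α x}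
      ... | yes ux = K.sym (begin
        restrict difference Q x + outside x      ≈⟨ K.+-congʳ (restrict-∈ difference Q (sup (px , ux))) ⟩
        inside x + - outside x + outside x       ≈⟨ K.+-assoc _ _ _ ⟩
        inside x + (- outside x + outside x)     ≈⟨ K.+-congˡ (K.-‿inverseˡ (outside x)) ⟩
        inside x + 0#                            ≈⟨ K.+-identityʳ (inside x) ⟩
        inside x                                 ≈⟨ saturate-≈ det-in (same-refl αs) (px , ux) ⟩
        h x                                      ∎)
        where open SetoidReasoning K.setoid
      ... | no ¬ux = K.sym (begin
        restrict difference Q x + outside x  ≈⟨ K.+-congʳ (restrict-∉ difference Q (¬ux ∘ proj₂ ∘ sub)) ⟩
        0# + outside x                       ≈⟨ K.+-identityˡ (outside x) ⟩
        outside x                            ≈⟨ saturate-≈ det-out (same-refl αs) (px , ¬ux) ⟩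
        h x                                  ∎)
        where open SetoidReasoning K.setoid

    -- Each condition is traded for two shorter problems: `difference` on the cell `U a ∩ U α`, and
    -- `outside` on `U a` itself. With no conditions left, the function is constant on `U a`, hence
    -- a multiple of one indicator.
    span-restrict : ∀ αs h a → DeterminedOn (U a) αs h → InSpan (restrict h (U a))
    span-restrict [] h a det with em {P = ∃[ x ] U a x}
    ... | no empty = nil λ x → restrict-∉ h (U a) λ m → empty (x , m)
    ... | yes (x₀ , m₀) with indicator a (x₀ , m₀)
    ...   | b , ind = cons (h x₀) b (nil {λ _ → 0#} λ _ → K.refl) λ x → K.trans (constant x em) (K.sym (K.+-identityʳ _))
      where
      constant : ∀ x → Dec (U a x) → restrict h (U a) x ≋ h x₀ * ⟦ b ⟧ x
      constant x (yes m) = K.trans (restrict-∈ h (U a) m) (K.trans (det x x₀ [] m m₀)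
        (K.sym (K.trans (K.*-congˡ (proj₁ (ind x) m)) (K.*-identityʳ _))))
      constant x (no ¬m) = K.trans (restrict-∉ h (U a) ¬m)
        (K.sym (K.trans (K.*-congˡ (proj₂ (ind x) ¬m)) (K.zeroʳ _)))
    span-restrict (α ∷ αs) h a det with em {P = ∃[ x ] U a x × U α x}
    ... | yes (x₀ , m , mα) with ∩-closed a α x₀ m mα
    ...   | d , sub , sup = span-resp (λ x → eq x em) (span-+
        (span-restrict αs diff d (λ x y s _ _ → difference-determined (U a) α αs h det x y s))
        (span-restrict αs out a (λ x y s _ _ → outside-determined (U a) α αs h det x y s)))
      where
      diff = difference (U a) α αs h det
      out  = outside (U a) α αs h det

      eq : ∀ x → Dec (U a x) → restrict diff (U d) x + restrict out (U a) x ≋ restrict h (U a) x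
      eq x (yes ux) = K.trans (K.+-congˡ (restrict-∈ out (U a) ux))
        (K.trans (K.sym (split (U a) α αs h det (U d) sub sup x ux)) (K.sym (restrict-∈ h (U a) ux)))
      eq x (no ¬ux) = K.trans (K.+-cong (restrict-∉ diff (U d) (¬ux ∘ proj₁ ∘ sub)) (restrict-∉ out (U a) ¬ux))
        (K.trans (K.+-identityˡ 0#) (K.sym (restrict-∉ h (U a) ¬ux)))
    -- Here `α` fails throughout `U a`, so any two points of it agree on `α` and the condition can
    -- simply be discarded.
    span-restrict (α ∷ αs) h a det | no disjoint = span-restrict αs h a λ x y s ux uy →
      det x y (((λ m → contradiction (x , ux , m) disjoint) ,
                (λ m → contradiction (y , uy , m) disjoint)) ∷ s) ux uy

    -- All of `I` need not be a cell, so the `outside` part cannot be passed to `span-restrict`. It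
    -- stays a function on `I` that vanishes wherever all remaining conditions fail, and is zero
    -- once the conditions are used up.
    span-vanishing : ∀ αs h → DeterminedOn (λ _ → ⊤) αs h →
                     (∀ x → All (λ α → ¬ U α x) αs → h x ≋ 0#) → InSpan h
    span-vanishing [] h det vanish = nil λ x → vanish x []
    span-vanishing (α ∷ αs) h det vanish = span-resp
      (λ x → K.sym (split (λ _ → ⊤) α αs h det (U α) (tt ,_) proj₂ x tt))
      (span-+
        (span-restrict αs _ α (λ x y s _ _ → difference-determined (λ _ → ⊤) α αs h det x y s))
        (span-vanishing αs _ (λ x y s _ _ → outside-determined (λ _ → ⊤) α αs h det x y s)
          λ x none → saturate-0 λ {y} s (_ , ¬uy) → vanish y (¬uy ∷
            All.zipWith (λ (¬u , _ , f) → ¬u ∘ f) (none , s))))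

    span-all : ∀ αs h → DeterminedOn (λ _ → ⊤) αs h → (∀ x → Any (λ α → U α x) αs) → InSpan h
    span-all αs h det covers = span-vanishing αs h det λ x none →
      contradiction (covers x) (λ any → uncovered none any)
      where
      uncovered : ∀ {x αs} → All (λ α → ¬ U α x) αs → ¬ Any (λ α → U α x) αs
      uncovered (¬u ∷ _) (here u)   = ¬u u
      uncovered (_ ∷ ¬us) (there m) = uncovered ¬us m

-- Automorphisms of ⟨ℚ, ≤⟩

open import Data.Rational.Base using (_+_; _*_; _-_; -_; 1/_)

mkAut : (f g : ℚ → ℚ) →
        (∀ {p q} → p ≤ q → f p ≤ f q) → (∀ {p q} → p ≤ q → g p ≤ g q) →
        (∀ q → f (g q) ≡ q) → (∀ q → g (f q) ≡ q) → Aut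
mkAut f g f-mono g-mono fg gf = record
  { to = f
  ; isOrderIsomorphism = record
    { isOrderMonomorphism = record
      { isOrderHomomorphism = record { cong = ≡.cong f ; mono = f-mono }
      ; injective = λ eq → ≡.trans (≡.sym (gf _)) (≡.trans (≡.cong g eq) (gf _))
      ; cancel = λ le → ≡.subst₂ _≤_ (gf _) (gf _) (g-mono le)
      }
    ; surjective = λ q → g q , λ { refl → fg q }
    }
  }

infixr 9 _⟨$⟩_

_⟨$⟩_ : Aut → ℚ → ℚ
_⟨$⟩_ = Aut.to

module _ (π : Aut) where
  open IsOrderIsomorphism (Aut.isOrderIsomorphism π)

  from : ℚ → ℚ
  from q = proj₁ (surjective q)

  to-from : ∀ q → π ⟨$⟩ from q ≡ q
  to-from q = proj₂ (surjective q) refl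

  from-to : ∀ q → from (π ⟨$⟩ q) ≡ q
  from-to q = injective (to-from _)

  to-mono : ∀ {p q} → p ≤ q → π ⟨$⟩ p ≤ π ⟨$⟩ q
  to-mono = mono

  from-mono : ∀ {p q} → p ≤ q → from p ≤ from q
  from-mono p≤q = cancel (≡.subst₂ _≤_ (≡.sym (to-from _)) (≡.sym (to-from _)) p≤q)

  to-mono-< : ∀ {p q} → p < q → π ⟨$⟩ p < π ⟨$⟩ q
  to-mono-< p<q = ℚ.≰⇒> λ le → <-irrefl refl (<-≤-trans p<q (cancel le))

  to-cancel-< : ∀ {p q} → π ⟨$⟩ p < π ⟨$⟩ q → p < q
  to-cancel-< lt = ℚ.≰⇒> λ le → <-irrefl refl (<-≤-trans lt (mono le))

  to-injective : ∀ {p q} → π ⟨$⟩ p ≡ π ⟨$⟩ q → p ≡ q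
  to-injective = injective

idᴬ : Aut
idᴬ = mkAut id id id id (λ _ → refl) (λ _ → refl)

infixr 9 _∘ᴬ_
infix 10 _⁻¹
infixr 8 _⊔ᴬ_ _⊓ᴬ_

_⁻¹ : Aut → Aut
π ⁻¹ = mkAut (from π) (Aut.to π) (from-mono π) (to-mono π) (from-to π) (to-from π)

_∘ᴬ_ : Aut → Aut → Aut
π ∘ᴬ σ = mkAut (Aut.to π ∘ Aut.to σ) (from σ ∘ from π)
  (to-mono π ∘ to-mono σ) (from-mono σ ∘ from-mono π)
  (λ q → ≡.trans (≡.cong (Aut.to π) (to-from σ _)) (to-from π q))
  (λ q → ≡.trans (≡.cong (from σ) (from-to π _)) (from-to σ q))

abstract
  -- The pointwise maximum is bijective because the pointwise minimum of the inverses inverts it: at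
  -- the smaller of the two preimages of `q`, one automorphism takes the value `q` and the other at
  -- most `q`.
  _⊔ᴬ_ : Aut → Aut → Aut
  π ⊔ᴬ σ = mkAut f g
    (λ le → ⊔-mono-≤ (to-mono π le) (to-mono σ le))
    (λ le → ⊓-mono-≤ (from-mono π le) (from-mono σ le))
    fg gf
    where
    f g : ℚ → ℚ
    f q = (π ⟨$⟩ q) ℚ.⊔ (σ ⟨$⟩ q)
    g q = from π q ℚ.⊓ from σ q

    fg : ∀ q → f (g q) ≡ q
    fg q with ≤-total (from π q) (from σ q)
    ... | inj₁ le rewrite p≤q⇒p⊓q≡p le | to-from π q =
      p≥q⇒p⊔q≡p (≡.subst (σ ⟨$⟩ from π q ≤_) (to-from σ q) (to-mono σ le))
    ... | inj₂ le rewrite p≥q⇒p⊓q≡q le | to-from σ q =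
      p≤q⇒p⊔q≡q (≡.subst (π ⟨$⟩ from σ q ≤_) (to-from π q) (to-mono π le))

    gf : ∀ q → g (f q) ≡ q
    gf q with ≤-total (π ⟨$⟩ q) (σ ⟨$⟩ q)
    ... | inj₁ le rewrite p≤q⇒p⊔q≡q le | from-to σ q =
      p≥q⇒p⊓q≡q (≡.subst (_≤ from π (σ ⟨$⟩ q)) (from-to π q) (from-mono π le))
    ... | inj₂ le rewrite p≥q⇒p⊔q≡p le | from-to π q =
      p≤q⇒p⊓q≡p (≡.subst (_≤ from σ (π ⟨$⟩ q)) (from-to σ q) (from-mono σ le))

  _⊓ᴬ_ : Aut → Aut → Aut
  π ⊓ᴬ σ = (π ⁻¹ ⊔ᴬ σ ⁻¹) ⁻¹

  ⊔ᴬ-to : ∀ π σ q → (π ⊔ᴬ σ) ⟨$⟩ q ≡ (π ⟨$⟩ q) ℚ.⊔ (σ ⟨$⟩ q)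
  ⊔ᴬ-to π σ q = refl

  ⊓ᴬ-to : ∀ π σ q → (π ⊓ᴬ σ) ⟨$⟩ q ≡ (π ⟨$⟩ q) ℚ.⊓ (σ ⟨$⟩ q)
  ⊓ᴬ-to π σ q = refl

module _ (c u v : ℚ) .{{_ : Positive u}} .{{_ : Positive v}} where
  private
    instance
      u≢0 = pos⇒nonZero u
      v≢0 = pos⇒nonZero v

  open ℚ-Solver.+-*-Solver using (solve; _:=_; _:+_; _:*_; _:-_; con)

  private
    module _ (a b : ℚ) .{{_ : Positive a}} .{{_ : Positive b}} where
      instance
        a≢0 = pos⇒nonZero a
        b≢0 = pos⇒nonZero b

      f : ℚ → ℚ
      f q = c + (a * 1/ b) * (q - c)

      f-mono : ∀ {p q} → p ≤ q → f p ≤ f q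
      f-mono p≤q = +-monoʳ-≤ c (*-monoˡ-≤-nonNeg (a * 1/ b)
        {{pos⇒nonNeg (a * 1/ b) {{pos*pos⇒pos a (1/ b) {{1/pos⇒pos b}}}}}} (+-monoˡ-≤ (- c) p≤q))

    inverse-slopes : ∀ a b .{{_ : Positive a}} .{{_ : Positive b}} →
                     ∀ q → f a b (f b a q) ≡ q
    inverse-slopes a b q = begin
      c + (a * 1/ b) * ((c + (b * 1/ a) * (q - c)) - c)
        ≡⟨ solve 6 (λ a b a⁻¹ b⁻¹ c q →
             c :+ (a :* b⁻¹) :* ((c :+ (b :* a⁻¹) :* (q :- c)) :- c) :=
             c :+ (a :* a⁻¹) :* (b :* b⁻¹) :* (q :- c)) refl a b (1/ a) (1/ b) c q ⟩
      c + (a * 1/ a) * (b * 1/ b) * (q - c)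
        ≡⟨ ≡.cong₂ (λ s t → c + s * t * (q - c)) (*-inverseʳ a) (*-inverseʳ b) ⟩
      c + 1ℚ * 1ℚ * (q - c)
        ≡⟨ solve 2 (λ c q → c :+ con 1ℚ :* con 1ℚ :* (q :- c) := q) refl c q ⟩
      q ∎
      where
      open ≡.≡-Reasoning
      instance
        a≢0′ = pos⇒nonZero a
        b≢0′ = pos⇒nonZero b

  private
    1/u≥0 : NonNegative (1/ u)
    1/u≥0 = pos⇒nonNeg (1/ u) {{1/pos⇒pos u}}

    collapse : ∀ q → c + 1ℚ * (q - c) ≡ q
    collapse q = solve 2 (λ c q → c :+ con 1ℚ :* (q :- c) := q) refl c q

  abstract
    -- The dilation with centre `c` and ratio `v / u`. Giving the ratio by two lengths makes the
    -- inverse the same map with the lengths swapped.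
    affine : Aut
    affine = mkAut (f v u) (f u v) (f-mono v u) (f-mono u v)
      (inverse-slopes v u) (inverse-slopes u v)

    -- `k` measures the displacement from the centre in units of `u`; it is `1ℚ` for a point at
    -- distance `u` above the centre and `- 1ℚ` for one below.
    affine-at : ∀ {q} k → q - c ≡ k * u → affine ⟨$⟩ q ≡ c + k * v
    affine-at k eq rewrite eq = begin
      c + (v * 1/ u) * (k * u)
        ≡⟨ solve 5 (λ c v u⁻¹ k u → c :+ (v :* u⁻¹) :* (k :* u) := c :+ k :* v :* (u :* u⁻¹))
             refl c v (1/ u) k u ⟩
      c + k * v * (u * 1/ u) ≡⟨ ≡.cong (λ s → c + k * v * s) (*-inverseʳ u) ⟩
      c + k * v * 1ℚ         ≡⟨ ≡.cong (c +_) (*-identityʳ _) ⟩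
      c + k * v              ∎
      where open ≡.≡-Reasoning

    affine-below : u ≤ v → ∀ {q} → q ≤ c → affine ⟨$⟩ q ≤ q
    affine-below u≤v {q} q≤c = ≡.subst (affine ⟨$⟩ q ≤_) (collapse q)
      (+-monoʳ-≤ c (*-monoʳ-≤-nonPos (q - c)
        {{nonPositive (≡.subst (q - c ≤_) (+-inverseʳ c) (+-monoˡ-≤ (- c) q≤c))}}
        (≡.subst (_≤ v * 1/ u) (*-inverseʳ u) (*-monoʳ-≤-nonNeg (1/ u) {{1/u≥0}} u≤v))))

    affine-above : v ≤ u → ∀ {q} → c ≤ q → affine ⟨$⟩ q ≤ q
    affine-above v≤u {q} c≤q = ≡.subst (affine ⟨$⟩ q ≤_) (collapse q)
      (+-monoʳ-≤ c (*-monoʳ-≤-nonNeg (q - c)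
        {{nonNegative (≡.subst (_≤ q - c) (+-inverseʳ c) (+-monoˡ-≤ (- c) c≤q))}}
        (≡.subst (v * 1/ u ≤_) (*-inverseʳ u) (*-monoʳ-≤-nonNeg (1/ u) {{1/u≥0}} v≤u))))

p<q⇒0<q-p : ∀ {p q} → p < q → 0ℚ < q - p
p<q⇒0<q-p {p} {q} p<q = ≡.subst (_< q - p) (+-inverseʳ p) (+-monoˡ-< (- p) p<q)

abstract
  -- A piecewise linear automorphism obtained as a lattice combination of the identity and two
  -- dilations, about `c` and about `d`, that both send `p` to `q`. The lattice operations preserve
  -- automorphisms, so no gluing has to be verified.
  bump : ∀ {c p q d} → c < p → p ≤ q → q < d →
         ∃[ σ ] σ ⟨$⟩ p ≡ q × (∀ {x} → x ≤ c → σ ⟨$⟩ x ≡ x) × (∀ {x} → d ≤ x → σ ⟨$⟩ x ≡ x)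
  bump {c} {p} {q} {d} c<p p≤q q<d = σ , p↦q , below , above
    where
    open ℚ-Solver.+-*-Solver using (solve; _:=_; _:+_; _:*_; _:-_; con)

    p-c : Positive (p - c)
    p-c = positive (p<q⇒0<q-p {c} {p} c<p)
    q-c : Positive (q - c)
    q-c = positive (p<q⇒0<q-p {c} {q} (<-≤-trans c<p p≤q))
    d-p : Positive (d - p)
    d-p = positive (p<q⇒0<q-p {p} {d} (≤-<-trans p≤q q<d))
    d-q : Positive (d - q)
    d-q = positive (p<q⇒0<q-p {q} {d} q<d)

    h g : Aut
    h = affine c (p - c) (q - c) {{p-c}} {{q-c}}
    g = affine d (d - p) (d - q) {{d-p}} {{d-q}}

    h-q : c + 1ℚ * (q - c) ≡ q
    h-q = solve 2 (λ c q → c :+ con 1ℚ :* (q :- c) := q) refl c q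

    g-q : d + - 1ℚ * (d - q) ≡ q
    g-q = solve 2 (λ d q → d :+ con (- 1ℚ) :* (d :- q) := q) refl d q

    g-p₀ : p - d ≡ - 1ℚ * (d - p)
    g-p₀ = solve 2 (λ d p → p :- d := con (- 1ℚ) :* (d :- p)) refl d p

    h-p : h ⟨$⟩ p ≡ q
    h-p = ≡.trans (affine-at c (p - c) (q - c) {{p-c}} {{q-c}} {p} 1ℚ (≡.sym (*-identityˡ (p - c)))) h-q

    g-p : g ⟨$⟩ p ≡ q
    g-p = ≡.trans (affine-at d (d - p) (d - q) {{d-p}} {{d-q}} {p} (- 1ℚ) g-p₀) g-q

    -- h ≤ id below c and g ≤ id above d, so there the join with id is id.
    σ : Aut
    σ = idᴬ ⊔ᴬ (h ⊓ᴬ g)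

    σ-to : ∀ x → σ ⟨$⟩ x ≡ x ℚ.⊔ ((h ⟨$⟩ x) ℚ.⊓ (g ⟨$⟩ x))
    σ-to x = ≡.trans (⊔ᴬ-to idᴬ (h ⊓ᴬ g) x) (≡.cong (x ℚ.⊔_) (⊓ᴬ-to h g x))

    p↦q : σ ⟨$⟩ p ≡ q
    p↦q = begin
      σ ⟨$⟩ p                             ≡⟨ σ-to p ⟩
      p ℚ.⊔ ((h ⟨$⟩ p) ℚ.⊓ (g ⟨$⟩ p))         ≡⟨ ≡.cong₂ (λ s t → p ℚ.⊔ (s ℚ.⊓ t)) h-p g-p ⟩
      p ℚ.⊔ (q ℚ.⊓ q)                         ≡⟨ ≡.cong (p ℚ.⊔_) (⊓-idem q) ⟩
      p ℚ.⊔ q                               ≡⟨ p≤q⇒p⊔q≡q p≤q ⟩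
      q                                   ∎
      where open ≡.≡-Reasoning

    below : ∀ {x} → x ≤ c → σ ⟨$⟩ x ≡ x
    below {x} x≤c = ≡.trans (σ-to x) (p≥q⇒p⊔q≡p (≤-trans (p⊓q≤p (h ⟨$⟩ x) (g ⟨$⟩ x))
      (affine-below c (p - c) (q - c) {{p-c}} {{q-c}} (+-monoˡ-≤ (- c) p≤q) x≤c)))

    above : ∀ {x} → d ≤ x → σ ⟨$⟩ x ≡ x
    above {x} d≤x = ≡.trans (σ-to x) (p≥q⇒p⊔q≡p (≤-trans (p⊓q≤q (h ⟨$⟩ x) (g ⟨$⟩ x))
      (affine-above d (d - p) (d - q) {{d-p}} {{d-q}} (+-monoʳ-≤ d (neg-antimono-≤ p≤q)) d≤x)))

abstract
  gap-below : ∀ p (L : List ℚ) → ∃[ c ] c < p × (∀ {x} → x ∈ₗ L → x < p → x ≤ c)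
  gap-below p [] = p - 1ℚ , ≡.subst (p - 1ℚ <_) (+-identityʳ p) (+-monoʳ-< p (negative⁻¹ (- 1ℚ))) , λ ()
  gap-below p (x ∷ L) with gap-below p L | <-cmp x p
  ... | c , c<p , low | tri< x<p _ _ = c ℚ.⊔ x , ⊔<p , λ
      { (here refl) _ → p≤q⊔p c x
      ; (there m) lt → ≤-trans (low m lt) (p≤p⊔q c x) }
    where
    ⊔<p : c ℚ.⊔ x < p
    ⊔<p with ⊔-sel c x
    ... | inj₁ eq rewrite eq = c<p
    ... | inj₂ eq rewrite eq = x<p
  ... | c , c<p , low | tri≈ x≮p _ _ = c , c<p , λ
      { (here refl) lt → contradiction lt x≮p ; (there m) → low m }
  ... | c , c<p , low | tri> x≮p _ _ = c , c<p , λ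
      { (here refl) lt → contradiction lt x≮p ; (there m) → low m }

  gap-above : ∀ p (L : List ℚ) → ∃[ d ] p < d × (∀ {x} → x ∈ₗ L → p < x → d ≤ x)
  gap-above p [] = p + 1ℚ , ≡.subst (_< p + 1ℚ) (+-identityʳ p) (+-monoʳ-< p (positive⁻¹ 1ℚ)) , λ ()
  gap-above p (x ∷ L) with gap-above p L | <-cmp p x
  ... | d , p<d , high | tri< p<x _ _ = d ℚ.⊓ x , p<⊓ , λ
      { (here refl) _ → p⊓q≤q d x
      ; (there m) lt → ≤-trans (p⊓q≤p d x) (high m lt) }
    where
    p<⊓ : p < d ℚ.⊓ x
    p<⊓ with ⊓-sel d x
    ... | inj₁ eq rewrite eq = p<d
    ... | inj₂ eq rewrite eq = p<x
  ... | d , p<d , high | tri≈ p≮x _ _ = d , p<d , λ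
      { (here refl) lt → contradiction lt p≮x ; (there m) → high m }
  ... | d , p<d , high | tri> p≮x _ _ = d , p<d , λ
      { (here refl) lt → contradiction lt p≮x ; (there m) → high m }

infix 4 _FixesAll_

_FixesAll_ : Aut → List ℚ → Set
σ FixesAll L = ∀ {x} → x ∈ₗ L → σ ⟨$⟩ x ≡ x

fixesAll-⁻¹ : ∀ σ L → σ FixesAll L → (σ ⁻¹) FixesAll L
fixesAll-⁻¹ σ L fix m = ≡.trans (≡.cong (from σ) (≡.sym (fix m))) (from-to σ _)

abstract
  between : ∀ {p q} → p < q → ∃[ r ] p < r × r < q
  between p<q = ℚ.<-dense p<q

abstract
  nudge : ∀ {p u} → p < u → (L : List ℚ) →
          ∃[ σ ] p < σ ⟨$⟩ p × σ ⟨$⟩ p < u × (∀ {x} → x ∈ₗ L → x ≢ p → σ ⟨$⟩ x ≡ x)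
  nudge {p} {u} p<u L =
    let c , c<p , low = gap-below p L
        -- Adding `u` to the list forces `d ≤ u`, which keeps the image of `p` below `u`.
        d , p<d , high = gap-above p (u ∷ L)
        q , p<q , q<d = between p<d
        σ , σp≡q , below , above = bump c<p (<⇒≤ p<q) q<d
    in σ , ≡.subst (p <_) (≡.sym σp≡q) p<q
         , ≡.subst (_< u) (≡.sym σp≡q) (<-≤-trans q<d (high (here refl) p<u))
         , λ {x} m x≢p → fix σ below above (low m) (high (there m)) (<-cmp x p) x≢p
    where
    fix : ∀ {c d x} (σ : Aut) → (∀ {x} → x ≤ c → σ ⟨$⟩ x ≡ x) → (∀ {x} → d ≤ x → σ ⟨$⟩ x ≡ x) →
          (x < p → x ≤ c) → (p < x → d ≤ x) → Tri (x < p) (x ≡ p) (p < x) → x ≢ p → σ ⟨$⟩ x ≡ x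
    fix σ below above low high (tri< x<p _ _) _ = below (low x<p)
    fix σ below above low high (tri≈ _ eq _) x≢p = contradiction eq x≢p
    fix σ below above low high (tri> _ _ p<x) _ = above (high p<x)

-- Forward implications suffice: by trichotomy they can be reversed, which is `sameCut-sym`.
SameCut : ℚ → ℚ → List ℚ → Set
SameCut p q L = ∀ {x} → x ∈ₗ L → (p < x → q < x) × (x < p → x < q) × (p ≡ x → q ≡ x)

sameCut-sym : ∀ {p q} L → SameCut p q L → SameCut q p L
sameCut-sym {p} {q} L same {x} m with <-cmp p x | same m
... | tri< p<x p≢x _ | f , _ , _ =
  (λ _ → p<x) , (λ x<q → contradiction (<-trans x<q (f p<x)) (<-irrefl refl)) ,
  (λ { refl → contradiction (f p<x) (<-irrefl refl) })
... | tri≈ _ p≡x _ | _ , _ , f =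
  (λ q<x → contradiction q<x (<-irrefl (f p≡x))) ,
  (λ x<q → contradiction x<q (<-irrefl (≡.sym (f p≡x)))) , (λ _ → p≡x)
... | tri> _ _ x<p | _ , f , _ =
  (λ q<x → contradiction (<-trans q<x (f x<p)) (<-irrefl refl)) , (λ _ → x<p) ,
  (λ { refl → contradiction (f x<p) (<-irrefl refl) })

private
  module _ {p q : ℚ} (L : List ℚ) (p<q : p < q) (same : SameCut p q L)
           (gb : ∃[ c ] c < p × (∀ {x} → x ∈ₗ L → x < p → x ≤ c))
           (ga : ∃[ d ] q < d × (∀ {x} → x ∈ₗ L → q < x → d ≤ x)) where

    -- Having the same cut, `p` and `q` have no element of `L` between them, endpoints included. A
    -- bump confined to the gap that reaches below `p` and above `q` therefore fixes `L`.
    move-up′ : ∃[ σ ] σ FixesAll L × σ ⟨$⟩ p ≡ q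
    move-up′ =
      let c , c<p , low = gb
          d , q<d , high = ga
          σ , eq , below , above = bump c<p (<⇒≤ p<q) q<d
      in σ , (λ {x} m → fix σ below above (low m) (high m) (<-cmp p x) (same m)) , eq
      where
      fix : ∀ {c d x} (σ : Aut) → (∀ {x} → x ≤ c → σ ⟨$⟩ x ≡ x) → (∀ {x} → d ≤ x → σ ⟨$⟩ x ≡ x) →
            (x < p → x ≤ c) → (q < x → d ≤ x) → Tri (p < x) (p ≡ x) (x < p) →
            (p < x → q < x) × (x < p → x < q) × (p ≡ x → q ≡ x) → σ ⟨$⟩ x ≡ x
      fix σ below above low high (tri< p<x _ _) (f , _ , _) = above (high (f p<x))
      fix σ below above low high (tri≈ _ p≡x _) (_ , _ , f) =
        contradiction p<q (<-irrefl (≡.trans p≡x (≡.sym (f p≡x))))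
      fix σ below above low high (tri> _ _ x<p) _ = below (low x<p)

  move-up : ∀ {p q} L → p < q → SameCut p q L → ∃[ σ ] σ FixesAll L × σ ⟨$⟩ p ≡ q
  move-up {p} {q} L p<q same = move-up′ L p<q same (gap-below p L) (gap-above q L)

abstract
  move : ∀ {p q} L → SameCut p q L → ∃[ σ ] σ FixesAll L × σ ⟨$⟩ p ≡ q
  move {p} {q} L same = by-cases (<-cmp p q)
    where
    by-cases : Tri (p < q) (p ≡ q) (q < p) → ∃[ σ ] σ FixesAll L × σ ⟨$⟩ p ≡ q
    by-cases (tri< p<q _ _)  = move-up L p<q same
    by-cases (tri≈ _ refl _) = idᴬ , (λ _ → refl) , refl
    by-cases (tri> _ _ q<p)  =
      let σ , fix , eq = move-up L q<p (sameCut-sym L same)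
      in σ ⁻¹ , fixesAll-⁻¹ σ L fix , ≡.trans (≡.cong (from σ) (≡.sym eq)) (from-to σ _)

-- Points are placed one at a time. Once `σ` has placed the tail, the image of the head has the same
-- cut as its target over `L` and the targets already reached, so `move` can finish while fixing all
-- of these.
homogeneous : ∀ L n (p q : Fin n → ℚ) → (∀ i → SameCut (p i) (q i) L) →
         (∀ i j → p i < p j → q i < q j) → (∀ i j → p i ≡ p j → q i ≡ q j) →
         ∃[ σ ] σ FixesAll L × (∀ i → σ ⟨$⟩ p i ≡ q i)
homogeneous L ℕ.zero p q same lt eq = idᴬ , (λ _ → refl) , λ ()
homogeneous L (ℕ.suc n) p q same lt eq =
  let σ , σ-fix , σ-eq = homogeneous L n (p ∘ suc) (q ∘ suc) (same ∘ suc)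
        (λ i j → lt (suc i) (suc j)) (λ i j → eq (suc i) (suc j))
      τ , τ-fix , τ-eq = move (L ++ tabulate (q ∘ suc)) (cut σ σ-fix σ-eq)
  in τ ∘ᴬ σ
   , (λ m → ≡.trans (≡.cong (Aut.to τ) (σ-fix m)) (τ-fix (∈-++⁺ˡ m)))
   , λ { zero → τ-eq
       ; (suc i) → ≡.trans (≡.cong (Aut.to τ) (σ-eq i)) (τ-fix (∈-++⁺ʳ L (∈-tabulate⁺ i))) }
  where
  cut : ∀ σ → σ FixesAll L → (∀ i → σ ⟨$⟩ p (suc i) ≡ q (suc i)) →
        SameCut (σ ⟨$⟩ p zero) (q zero) (L ++ tabulate (q ∘ suc))
  cut σ σ-fix σ-eq {x} m with ∈-++⁻ L m
  ... | inj₁ x∈L = let f , g , h = same zero x∈L in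
    (λ l → f (to-cancel-< σ (≡.subst (σ ⟨$⟩ p zero <_) (≡.sym (σ-fix x∈L)) l))) ,
    (λ l → g (to-cancel-< σ (≡.subst (_< σ ⟨$⟩ p zero) (≡.sym (σ-fix x∈L)) l))) ,
    (λ e → h (to-injective σ (≡.trans e (≡.sym (σ-fix x∈L)))))
  ... | inj₂ x∈q with ∈-tabulate⁻ x∈q
  ... | i , refl =
    (λ l → lt zero (suc i) (to-cancel-< σ (≡.subst (σ ⟨$⟩ p zero <_) (≡.sym (σ-eq i)) l))) ,
    (λ l → lt (suc i) zero (to-cancel-< σ (≡.subst (_< σ ⟨$⟩ p zero) (≡.sym (σ-eq i)) l))) ,
    (λ e → eq zero (suc i) (to-injective σ (≡.trans e (≡.sym (σ-eq i)))))

-- Least supports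

from-eq : ∀ π {p q} → π ⟨$⟩ p ≡ q → from π q ≡ p
from-eq π refl = from-to π _

·-id : ∀ π → (∀ q → π ⟨$⟩ q ≡ q) → (x : V ℓ) → π · x ≈ x
·-id π eq (atom q) = lift (eq q)
·-id π eq (set f)  = (λ i → i , ·-id π eq (f i)) , (λ i → i , ·-id π eq (f i))

-- The composite enters as any `ρ` with the right values. Automorphisms are thus only ever compared
-- pointwise, never equated as records.
·-∘ : ∀ π σ ρ → (∀ q → π ⟨$⟩ σ ⟨$⟩ q ≡ ρ ⟨$⟩ q) → (x : V ℓ) → π · σ · x ≈ ρ · x
·-∘ π σ ρ eq (atom q) = lift (eq q)
·-∘ π σ ρ eq (set f)  = (λ i → i , ·-∘ π σ ρ eq (f i)) , (λ i → i , ·-∘ π σ ρ eq (f i))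

·-cong : ∀ π (x y : V ℓ) → x ≈ y → π · x ≈ π · y
·-cong π (atom p) (atom q) (lift eq) = lift (≡.cong (Aut.to π) eq)
·-cong π (set f)  (set g)  (s , t)   =
  (λ i → proj₁ (s i) , ·-cong π (f i) _ (proj₂ (s i))) ,
  (λ j → proj₁ (t j) , ·-cong π _ (g j) (proj₂ (t j)))

·-trans : ∀ π σ ρ → (∀ q → π ⟨$⟩ σ ⟨$⟩ q ≡ ρ ⟨$⟩ q) →
          {x y z : V ℓ} → σ · x ≈ y → π · y ≈ z → ρ · x ≈ z
·-trans π σ ρ eq {x} {y} {z} σx≈y πy≈z =
  ≈-trans (ρ · x) (π · σ · x) z (≈-sym (π · σ · x) (ρ · x) (·-∘ π σ ρ eq x))
    (≈-trans (π · σ · x) (π · y) z (·-cong π (σ · x) y σx≈y) πy≈z)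

·-⁻¹ : ∀ π {x y : V ℓ} → π · x ≈ y → π ⁻¹ · y ≈ x
·-⁻¹ π {x} {y} πx≈y = ≈-trans (π ⁻¹ · y) (π ⁻¹ · π · x) x
  (·-cong (π ⁻¹) y (π · x) (≈-sym (π · x) y πx≈y))
  (≈-trans (π ⁻¹ · π · x) (idᴬ · x) x
    (·-∘ (π ⁻¹) π idᴬ (from-to π) x) (·-id idᴬ (λ _ → refl) x))

·-ext : ∀ π σ → (∀ q → π ⟨$⟩ q ≡ σ ⟨$⟩ q) → {x y : V ℓ} → π · x ≈ y → σ · x ≈ y
·-ext π σ eq {y = y} πx≈y = ·-trans idᴬ π σ eq πx≈y (·-id idᴬ (λ _ → refl) y)

fixes⇒fixesAll : ∀ {π A} → Fixes π A → π FixesAll A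
fixes⇒fixesAll = All.lookup

fixesAll⇒fixes : ∀ {π A} → π FixesAll A → Fixes π A
fixesAll⇒fixes fix = All.tabulate fix

fixesAll-∘ : ∀ {π σ A} → π FixesAll A → σ FixesAll A → (π ∘ᴬ σ) FixesAll A
fixesAll-∘ {π} f g m = ≡.trans (≡.cong (Aut.to π) (g m)) (f m)

SupportsOver : List ℚ → V ℓ → (n : ℕ) → (Fin n → ℚ) → Set ℓ
SupportsOver A x n s = ∀ π → π FixesAll A → (∀ i → π ⟨$⟩ s i ≡ s i) → π · x ≈ x

-- Irredundance is all that is recorded; that the stabiliser of `x` over `A` fixes every entry is
-- derived from it in `stabiliser-fixes`. The entries need not be listed in increasing order.
record IrredundantSupport (A : List ℚ) (x : V ℓ) : Set ℓ where
  field
    size        : ℕ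
    param       : Fin size → ℚ
    supports    : SupportsOver A x size param
    irredundant : ∀ j → ¬ (∀ π → π FixesAll A →
                  (∀ i → i ≢ j → π ⟨$⟩ param i ≡ param i) → π · x ≈ x)

module _ (em : ∀ {a} → ExcludedMiddle a) where

  least : ∀ {a} (P : ℕ → Set a) → ∀ n → P n → ∃[ m ] P m × (∀ k → k ℕ.< m → ¬ P k)
  least P = <-rec _ step
    where
    step : ∀ n → (∀ {k} → k ℕ.< n → P k → _) → P n → ∃[ m ] P m × (∀ k → k ℕ.< m → ¬ P k)
    step n rec pn with em {P = ∃[ k ] k ℕ.< n × P k}
    ... | yes (k , k<n , pk) = rec k<n pk
    ... | no none = n , pn , λ k k<n pk → none (k , k<n , pk)

  -- A support of minimal length will do: a redundant entry could be deleted, leaving a shorter one.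
  irredundantSupport : (A : List ℚ) (x : V ℓ) → FinitelySupported x → IrredundantSupport A x
  irredundantSupport A x (A′ , supp) =
    build (least (λ n → ∃[ s ] SupportsOver A x n s) (length A′)
      (lookup A′ , λ π _ fix → supp π (fixesAll⇒fixes {π} λ m →
        ≡.subst (λ q → π ⟨$⟩ q ≡ q) (≡.sym (lookup-index m)) (fix (index m)))))
    where
    build : (∃[ n ] (∃[ s ] SupportsOver A x n s) ×
             (∀ k → k ℕ.< n → ¬ (∃[ s ] SupportsOver A x k s))) → IrredundantSupport A x
    build (n , (s , supp) , minimal) = record
      { size = n ; param = s ; supports = supp ; irredundant = irr n s minimal }
      where
      irr : ∀ n (s : Fin n → ℚ) → (∀ k → k ℕ.< n → ¬ (∃[ s ] SupportsOver A x k s)) →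
            ∀ j → ¬ (∀ π → π FixesAll A → (∀ i → i ≢ j → π ⟨$⟩ s i ≡ s i) → π · x ≈ x)
      irr (suc n) s minimal j supp = minimal n (ℕ.n<1+n n) (s ∘ punchIn j , λ π fixA fix →
        supp π fixA λ i i≢j → ≡.subst (λ k → π ⟨$⟩ s k ≡ s k)
          (punchIn-punchOut (i≢j ∘ ≡.sym)) (fix (punchOut (i≢j ∘ ≡.sym))))

module _ {A : List ℚ} {x : V ℓ} (S : IrredundantSupport A x) where
  open IrredundantSupport S renaming (param to s)

  param∉ : ∀ j → ¬ s j ∈ₗ A
  param∉ j s∈A = irredundant j λ π fixA fix → supports π fixA λ i → by-cases π fixA fix i (i ≟ᶠ j)
    where
    by-cases : ∀ π → π FixesAll A → (∀ i → i ≢ j → π ⟨$⟩ s i ≡ s i) →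
               ∀ i → Dec (i ≡ j) → π ⟨$⟩ s i ≡ s i
    by-cases π fixA fix i (yes refl) = fixA s∈A
    by-cases π fixA fix i (no i≢j)   = fix i i≢j

  param-distinct : ∀ {i j} → i ≢ j → s i ≢ s j
  param-distinct {i₀} {j} i₀≢j eq = irredundant j λ π fixA fix →
    supports π fixA λ i → by-cases π fix i (i ≟ᶠ j)
    where
    by-cases : ∀ π → (∀ i → i ≢ j → π ⟨$⟩ s i ≡ s i) →
               ∀ i → Dec (i ≡ j) → π ⟨$⟩ s i ≡ s i
    by-cases π fix i (yes refl) = ≡.subst (λ q → π ⟨$⟩ q ≡ q) eq (fix i₀ i₀≢j)
    by-cases π fix i (no i≢j)   = fix i i≢j

  module _ (π : Aut) (π-fixA : π FixesAll A) (πx≈x : π · x ≈ x) (j : Fin size)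
           (moved : ∀ k → π ⟨$⟩ s k ≢ s j) where

    private
      -- σ agrees on the support with ρ ∘ τ, where τ moves s j only slightly and
      -- so fixes the support π s, and ρ fixes the support s.
      upwards : ∀ σ → σ FixesAll A → (∀ i → i ≢ j → σ ⟨$⟩ s i ≡ s i) →
                s j < σ ⟨$⟩ s j → σ · x ≈ x
      upwards σ σ-fixA σ-fix up =
        let τ , lo , hi , τ-fix = nudge up (A ++ tabulate s ++ tabulate (Aut.to π ∘ s))
            τ-fixA : τ FixesAll A
            τ-fixA = λ m → τ-fix (∈-++⁺ˡ m) λ { refl → param∉ j m }
            τ-fixs : ∀ i → i ≢ j → τ ⟨$⟩ s i ≡ s i
            τ-fixs = λ i i≢j → τ-fix (∈-++⁺ʳ A (∈-++⁺ˡ (∈-tabulate⁺ i))) (param-distinct i≢j)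
            τ-fixπs : ∀ i → τ ⟨$⟩ π ⟨$⟩ s i ≡ π ⟨$⟩ s i
            τ-fixπs = λ i → τ-fix (∈-++⁺ʳ A (∈-++⁺ʳ (tabulate s) (∈-tabulate⁺ i))) (moved i)
            -- Since `τ` fixes `A` and all `π ⟨$⟩ s i`, its conjugate by `π` fixes `A` and `s`,
            -- hence `x`. As `π` fixes `x`, so does `τ`.
            τx≈x : τ · x ≈ x
            τx≈x = ·-trans π (π ⁻¹ ∘ᴬ τ) τ (λ q → to-from π _)
              (·-trans (π ⁻¹ ∘ᴬ τ ∘ᴬ π) (π ⁻¹) (π ⁻¹ ∘ᴬ τ)
                (λ q → ≡.cong (λ p → from π (τ ⟨$⟩ p)) (to-from π q)) (·-⁻¹ π πx≈x)
                (supports (π ⁻¹ ∘ᴬ τ ∘ᴬ π)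
                  (λ m → from-eq π (≡.trans (π-fixA m)
                    (≡.sym (≡.trans (≡.cong (Aut.to τ) (π-fixA m)) (τ-fixA m)))))
                  (λ i → from-eq π (≡.sym (τ-fixπs i)))))
              πx≈x
            ρ , ρ-fix , ρ-eq = move (A ++ tabulate s) (cut τ lo hi)
            ρx≈x : ρ · x ≈ x
            ρx≈x = supports ρ (λ m → ρ-fix (∈-++⁺ˡ m))
                              (λ i → ρ-fix (∈-++⁺ʳ A (∈-tabulate⁺ i)))
            ρτx≈x : (ρ ∘ᴬ τ) · x ≈ x
            ρτx≈x = ·-trans ρ τ (ρ ∘ᴬ τ) (λ _ → refl) τx≈x ρx≈x
            κ = (ρ ∘ᴬ τ) ⁻¹ ∘ᴬ σ
            κx≈x : κ · x ≈ x
            κx≈x = supports κ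
              (λ m → from-eq (ρ ∘ᴬ τ) (≡.trans (≡.cong (Aut.to ρ) (τ-fixA m))
                (≡.trans (ρ-fix (∈-++⁺ˡ m)) (≡.sym (σ-fixA m)))))
              (λ i → from-eq (ρ ∘ᴬ τ) (agree (ρ ∘ᴬ τ) ρ-eq (λ i i≢j → ≡.trans
                (≡.cong (Aut.to ρ) (τ-fixs i i≢j)) (ρ-fix (∈-++⁺ʳ A (∈-tabulate⁺ i)))) i (i ≟ᶠ j)))
        in ·-trans (ρ ∘ᴬ τ) κ σ (λ q → to-from (ρ ∘ᴬ τ) _) κx≈x ρτx≈x
        where
        agree : ∀ π → π ⟨$⟩ s j ≡ σ ⟨$⟩ s j → (∀ i → i ≢ j → π ⟨$⟩ s i ≡ s i) →
                ∀ i → Dec (i ≡ j) → π ⟨$⟩ s i ≡ σ ⟨$⟩ s i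
        agree π at-j off-j i (yes refl) = at-j
        agree π at-j off-j i (no i≢j)   = ≡.trans (off-j i i≢j) (≡.sym (σ-fix i i≢j))

        module _ (τ : Aut) (lo : s j < τ ⟨$⟩ s j) (hi : τ ⟨$⟩ s j < σ ⟨$⟩ s j) where

          -- A fixed point of `σ` above `s j` is also above `σ ⟨$⟩ s j`, so none lies in the
          -- interval that contains both `τ ⟨$⟩ s j` and `σ ⟨$⟩ s j`.
          fixed-cut : ∀ {q} → σ ⟨$⟩ q ≡ q →
                      (τ ⟨$⟩ s j < q → σ ⟨$⟩ s j < q) × (q < τ ⟨$⟩ s j → q < σ ⟨$⟩ s j) ×
                      (τ ⟨$⟩ s j ≡ q → σ ⟨$⟩ s j ≡ q)
          fixed-cut {q} σq≡q =
            (λ lt → ≡.subst (σ ⟨$⟩ s j <_) σq≡q (to-mono-< σ (<-trans lo lt))) ,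
            (λ lt → <-trans lt hi) ,
            (λ { refl → contradiction
                   (<-trans hi (≡.subst (σ ⟨$⟩ s j <_) σq≡q (to-mono-< σ lo))) (<-irrefl refl) })

          cut : SameCut (τ ⟨$⟩ s j) (σ ⟨$⟩ s j) (A ++ tabulate s)
          cut m with ∈-++⁻ A m
          ... | inj₁ q∈A = fixed-cut (σ-fixA q∈A)
          ... | inj₂ q∈s with ∈-tabulate⁻ q∈s
          ... | i , refl with i ≟ᶠ j
          ... | no i≢j = fixed-cut (σ-fix i i≢j)
          ... | yes refl =
            (λ lt → contradiction (<-trans lo lt) (<-irrefl refl)) , (λ _ → up) ,
            (λ eq → contradiction lo (<-irrefl (≡.sym eq)))

    -- Both `s` and its image under `π` support `x` over `A`. An entry `s j` missing from the image
    -- could be varied freely without moving `x`, against irredundance; a downward move is the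
    -- inverse of an upward one.
    moved-absurd : ⊥
    moved-absurd = irredundant j λ σ σ-fixA σ-fix → by-cases σ σ-fixA σ-fix (<-cmp (s j) (σ ⟨$⟩ s j))
      where
      by-cases : ∀ σ → σ FixesAll A → (∀ i → i ≢ j → σ ⟨$⟩ s i ≡ s i) →
                 Tri (s j < σ ⟨$⟩ s j) (s j ≡ σ ⟨$⟩ s j) (σ ⟨$⟩ s j < s j) → σ · x ≈ x
      by-cases σ σ-fixA σ-fix (tri< up _ _) = upwards σ σ-fixA σ-fix up
      by-cases σ σ-fixA σ-fix (tri≈ _ eq _) = supports σ σ-fixA λ i → fix i (i ≟ᶠ j)
        where
        fix : ∀ i → Dec (i ≡ j) → σ ⟨$⟩ s i ≡ s i
        fix i (yes refl) = ≡.sym eq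
        fix i (no i≢j)   = σ-fix i i≢j
      by-cases σ σ-fixA σ-fix (tri> _ _ down) = ·-ext (σ ⁻¹ ⁻¹) σ (λ _ → refl) (·-⁻¹ (σ ⁻¹) (upwards (σ ⁻¹)
        (fixesAll-⁻¹ σ A σ-fixA) (λ i i≢j → from-eq σ (σ-fix i i≢j))
        (to-cancel-< σ (≡.subst (σ ⟨$⟩ s j <_) (≡.sym (to-from σ (s j))) down))))

  stabiliser-onto : ∀ π → π FixesAll A → π · x ≈ x → ∀ j → ∃[ k ] π ⟨$⟩ s k ≡ s j
  stabiliser-onto π π-fixA πx≈x j with any? (λ k → π ⟨$⟩ s k ℚ.≟ s j)
  ... | yes hit = hit
  ... | no miss = ⊥-elim (moved-absurd π π-fixA πx≈x j (λ k eq → miss (k , eq)))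

  private
    _⊏_ : Fin size → Fin size → Set
    j ⊏ i = s i < s j

    ⊏-wellFounded : ∀ i → Acc _⊏_ i
    ⊏-wellFounded = spo-wellFounded record
      { isEquivalence = ≡.isEquivalence
      ; irrefl = λ { refl → <-irrefl refl }
      ; trans = λ lt lt′ → <-trans lt′ lt
      ; <-resp-≈ = (λ { refl lt → lt }) , (λ { refl lt → lt })
      }

  -- Otherwise s j < π (s j) < π (π (s j)) < … would be an infinite ascent inside s.
  stabiliser-≮ : ∀ π → π FixesAll A → π · x ≈ x → ∀ j → ¬ (s j < π ⟨$⟩ s j)
  stabiliser-≮ π π-fixA πx≈x j = go (⊏-wellFounded j)
    where
    go : ∀ {j} → Acc _⊏_ j → ¬ (s j < π ⟨$⟩ s j)
    go {j} (acc rec) lt =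
      let k , eq = stabiliser-onto (π ⁻¹) (fixesAll-⁻¹ π A π-fixA) (·-⁻¹ π πx≈x) j
          πsj≡sk = ≡.trans (≡.cong (Aut.to π) (≡.sym eq)) (to-from π (s k))
      in go {k} (rec (≡.subst (s j <_) πsj≡sk lt))
           (≡.subst₂ (λ p q → p < π ⟨$⟩ q) πsj≡sk πsj≡sk (to-mono-< π lt))

  stabiliser-fixes : ∀ π → π FixesAll A → π · x ≈ x → ∀ j → π ⟨$⟩ s j ≡ s j
  stabiliser-fixes π π-fixA πx≈x j with <-cmp (s j) (π ⟨$⟩ s j)
  ... | tri< up _ _ = contradiction up (stabiliser-≮ π π-fixA πx≈x j)
  ... | tri≈ _ eq _ = ≡.sym eq
  ... | tri> _ _ down = contradiction
    (to-cancel-< π (≡.subst (π ⟨$⟩ s j <_) (≡.sym (to-from π (s j))) down))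
    (stabiliser-≮ (π ⁻¹) (fixesAll-⁻¹ π A π-fixA) (·-⁻¹ π πx≈x) j)

-- Literals and their orbits

sameCut-trans : ∀ {p q r} L → SameCut p q L → SameCut q r L → SameCut p r L
sameCut-trans L s t m = let f , g , h = s m ; f′ , g′ , h′ = t m in f′ ∘ f , g′ ∘ g , h′ ∘ h

data Literal : Set where
  free  : Literal
  below : ℚ → Literal
  at    : ℚ → Literal

infix 4 _⊨_

_⊨_ : ℚ → Literal → Set
q ⊨ free    = ⊤
q ⊨ below p = q < p
q ⊨ at p    = q ≡ p

mapᴸ : Aut → Literal → Literal
mapᴸ π free      = free
mapᴸ π (below p) = below (π ⟨$⟩ p)
mapᴸ π (at p)    = at (π ⟨$⟩ p)

mapᴸ-∘ : ∀ π σ l → mapᴸ π (mapᴸ σ l) ≡ mapᴸ (π ∘ᴬ σ) l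
mapᴸ-∘ π σ free      = refl
mapᴸ-∘ π σ (below p) = refl
mapᴸ-∘ π σ (at p)    = refl

mapᴸ-id : ∀ {π} l → (∀ q → π ⟨$⟩ q ≡ q) → mapᴸ π l ≡ l
mapᴸ-id free      eq = refl
mapᴸ-id (below p) eq = ≡.cong below (eq p)
mapᴸ-id (at p)    eq = ≡.cong at (eq p)

mapᴸ-⁻¹ : ∀ π l → mapᴸ (π ⁻¹) (mapᴸ π l) ≡ l
mapᴸ-⁻¹ π l = ≡.trans (mapᴸ-∘ (π ⁻¹) π l) (mapᴸ-id l (from-to π))

mapᴸ-⁻¹′ : ∀ π l → mapᴸ π (mapᴸ (π ⁻¹) l) ≡ l
mapᴸ-⁻¹′ π l = ≡.trans (mapᴸ-∘ π (π ⁻¹) l) (mapᴸ-id l (to-from π))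

⊨-map : ∀ π {q} l → q ⊨ l → π ⟨$⟩ q ⊨ mapᴸ π l
⊨-map π free      _  = tt
⊨-map π (below p) lt = to-mono-< π lt
⊨-map π (at p)    eq = ≡.cong (Aut.to π) eq

parameters : Literal → List ℚ
parameters free      = []
parameters (below p) = p ∷ []
parameters (at p)    = p ∷ []

mapᴸ-fixed : ∀ {π} l → π FixesAll parameters l → mapᴸ π l ≡ l
mapᴸ-fixed free      fix = refl
mapᴸ-fixed (below p) fix = ≡.cong below (fix (here refl))
mapᴸ-fixed (at p)    fix = ≡.cong at (fix (here refl))

-- The common point `q` excludes contradictory pairs. In particular it is the value of any `at`
-- literal involved, which then implies the other literal.
meet : ∀ {q} l l′ → q ⊨ l → q ⊨ l′ →
       ∃[ l″ ] ∀ r → (r ⊨ l″ → (r ⊨ l) × (r ⊨ l′)) × ((r ⊨ l) × (r ⊨ l′) → r ⊨ l″)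
meet free l′ _ _ = l′ , λ r → (tt ,_) , proj₂
meet l free _ _ = l , λ r → (_, tt) , proj₁
meet (at p) l′ refl s = at p , λ r → (λ { refl → refl , s }) , proj₁
meet l (at p) s refl = at p , λ r → (λ { refl → s , refl }) , proj₂
meet (below p) (below p′) _ _ with ℚ.≤-total p p′
... | inj₁ p≤p′ = below p , λ r → (λ lt → lt , ℚ.<-≤-trans lt p≤p′) , proj₁
... | inj₂ p′≤p = below p′ , λ r → (λ lt → ℚ.<-≤-trans lt p′≤p , lt) , proj₂

module _ (em : ∀ {a} → ExcludedMiddle a) where

  -- The classes named by `rs` may be empty or overlap. Excluded middle decides which of them meet
  -- `P`, and one member is chosen from each of those.
  representatives : ∀ {c p r u} {C : Set c} {R : Set r} (P : Pred C p) (_∋_ : R → Pred C u)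
    (rs : List R) → (∀ y → P y → Any (_∋ y) rs) →
    ∃[ xs ] All P xs × (∀ y → P y → Any (λ x → ∃[ r ] r ∋ x × r ∋ y) xs)
  representatives {C = C} {R} P _∋_ rs covers =
    let xs , all , complete = choose rs in xs , all , λ y py → complete y py (covers y py)
    where
    choose : ∀ rs → ∃[ xs ] All P xs ×
             (∀ y → P y → Any (_∋ y) rs → Any (λ x → ∃[ r ] r ∋ x × r ∋ y) xs)
    choose [] = [] , [] , λ _ _ ()
    choose (r ∷ rs) with choose rs | em {P = ∃[ x ] P x × r ∋ x}
    ... | xs , all , complete | yes (x , px , r∋x) = x ∷ xs , px ∷ all , λ
      { y py (here r∋y) → here (r , r∋x , r∋y)
      ; y py (there m)  → there (complete y py m) }
    ... | xs , all , complete | no none = xs , all , λ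
      { y py (here r∋y) → contradiction (y , py , r∋y) none
      ; y py (there m)  → complete y py m }

  private
    data Side : Set where
      left centre right : Side

    Lies : ℚ → ℚ → Side → Set
    Lies a q left   = q < a
    Lies a q centre = q ≡ a
    Lies a q right  = a < q

    lies-cut : ∀ a {p q} x → Lies a p x → Lies a q x → SameCut p q (a ∷ [])
    lies-cut a left p<a q<a (here refl) =
      (λ _ → q<a) , (λ a<p → contradiction (<-trans p<a a<p) (<-irrefl refl)) ,
      (λ p≡a → contradiction p<a (<-irrefl p≡a))
    lies-cut a centre refl refl (here refl) = id , id , id
    lies-cut a right a<p a<q (here refl) =
      (λ p<a → contradiction (<-trans p<a a<p) (<-irrefl refl)) , (λ _ → a<q) ,
      (λ p≡a → contradiction a<p (<-irrefl (≡.sym p≡a)))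

    lies : ∀ a q → Any (Lies a q) (left ∷ centre ∷ right ∷ [])
    lies a q with <-cmp q a
    ... | tri< lt _ _ = here lt
    ... | tri≈ _ eq _ = there (here eq)
    ... | tri> _ _ gt = there (there (here gt))

  -- Each new point `a` splits a class into at most three, by the side of `a`. Over the empty list
  -- all rationals are equivalent, so the initial representative is arbitrary.
  cut-representatives : ∀ L → ∃[ ps ] ∀ q → Any (λ p → SameCut q p L) ps
  cut-representatives [] = ℚ.0ℚ ∷ [] , λ q → here λ ()
  cut-representatives (a ∷ L) =
    let ps , covers = cut-representatives L
        qs , _ , complete = representatives (λ _ → ⊤) class
          (concatMap (λ p → map (p ,_) (left ∷ centre ∷ right ∷ [])) ps)
          λ q _ → concatMap⁺ _ (Any.map (λ s → map⁺ (Any.map (s ,_) (lies a q))) (covers q))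
    in qs , λ q → Any.map
         (λ { ((p , x) , (s , u) , (s′ , u′)) → λ
              { (here refl) → lies-cut a x u′ u (here refl)
              ; (there m)   → sameCut-trans L s′ (sameCut-sym L s) m } })
         (complete q tt)
    where
    class : ℚ × Side → Pred ℚ _
    class (p , x) q = SameCut q p L × Lies a q x

  -- The list `L` varies in the induction: after the head parameter has been brought to one of
  -- finitely many `p`, the tail is normalised over `p ∷ L`, so the head stays in place.
  literal-representatives : ∀ n L → ∃[ rs ] ∀ (v : Vector Literal n) →
    Any (λ r → ∃[ σ ] σ FixesAll L × (∀ i → mapᴸ σ (v i) ≡ r i)) rs
  literal-representatives zero L = (λ ()) ∷ [] , λ v → here (idᴬ , (λ _ → refl) , λ ())
  literal-representatives (suc n) L =
    map (free Vector.∷_) (proj₁ (literal-representatives n L)) ++ concatMap block (proj₁ (cut-representatives L)) ,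
    λ v → cover v (v zero) refl
    where
    tails : ℚ → List (Vector Literal n)
    tails p = proj₁ (literal-representatives n (p ∷ L))

    block : ℚ → List (Vector Literal (suc n))
    block p = map (below p Vector.∷_) (tails p) ++ map (at p Vector.∷_) (tails p)

    Conjugate : ∀ {n} → Vector Literal n → Vector Literal n → Set
    Conjugate v r = ∃[ σ ] σ FixesAll L × (∀ i → mapᴸ σ (v i) ≡ r i)

    -- Move q to its representative p first, and the other literals next, fixing p.
    at-representative : ∀ v (con : ℚ → Literal) → (∀ π q → mapᴸ π (con q) ≡ con (π ⟨$⟩ q)) →
      ∀ {p q} → v zero ≡ con q → SameCut q p L →
      Any (Conjugate v) (map (con p Vector.∷_) (tails p))
    at-representative v con map-con {p} {q} eq same =
      let σ , σ-fix , σq≡p = move L same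
      in map⁺ (Any.map (λ { (τ , τ-fix , τ-eq) → τ ∘ᴬ σ ,
           (λ {x} m → ≡.trans (≡.cong (Aut.to τ) (σ-fix m)) (τ-fix (there m))) , λ
           { zero → ≡.trans (≡.cong (mapᴸ (τ ∘ᴬ σ)) eq) (≡.trans (map-con (τ ∘ᴬ σ) q)
               (≡.cong con (≡.trans (≡.cong (Aut.to τ) σq≡p) (τ-fix (here refl)))))
           ; (suc i) → ≡.trans (≡.sym (mapᴸ-∘ τ σ (v (suc i)))) (τ-eq i) } })
         (proj₂ (literal-representatives n (p ∷ L)) (λ i → mapᴸ σ (v (suc i)))))

    cover : ∀ v l → v zero ≡ l → Any (Conjugate v)
      (map (free Vector.∷_) (proj₁ (literal-representatives n L)) ++ concatMap block (proj₁ (cut-representatives L)))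
    cover v free eq = ++⁺ˡ (map⁺ (Any.map
      (λ { (σ , σ-fix , σ-eq) → σ , (λ {x} m → σ-fix m) , λ { zero → ≡.cong (mapᴸ σ) eq ; (suc i) → σ-eq i } })
      (proj₂ (literal-representatives n L) (v ∘ suc))))
    cover v (below q) eq = ++⁺ʳ _ (concatMap⁺ block (Any.map
      (λ {p} (same : SameCut q p L) → ++⁺ˡ (at-representative v below (λ _ _ → refl) eq same))
      (proj₂ (cut-representatives L) q)))
    cover v (at q) eq = ++⁺ʳ _ (concatMap⁺ block (Any.map
      (λ {p} (same : SameCut q p L) → ++⁺ʳ (map (below p Vector.∷_) (tails p))
        (at-representative v at (λ _ _ → refl) eq same))
      (proj₂ (cut-representatives L) q)))

-- Cells

element-finitelySupported : {X : V ℓ} → HereditarilyFinitelySupported X →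
                            ∀ i → FinitelySupported (element X i)
element-finitelySupported (set _ hfs) i = finitelySupported (hfs i)

-- The hypothesis speaks of members only, and says nothing about an atom; this is where `IsSet`
-- enters.
supportsMembers⇒invariant : ∀ {X : V ℓ} {A} → IsSet X →
  SupportsSubset (λ π x y → π · x ≈ y) A (_∈ X) → ∀ π → π FixesAll A → π · X ≈ X
supportsMembers⇒invariant (set {f = f}) supp π fix =
  let image , preimage = supp π (fixesAll⇒fixes {π} fix) in
  (λ i → let y , (j , y≈fj) , πfi≈y = image (f i) (i , ≈-refl (f i))
         in j , ≈-trans (π · f i) y (f j) πfi≈y y≈fj) ,
  (λ j → let x , (i , x≈fi) , πx≈fj = preimage (f j) (j , ≈-refl (f j))
         in i , ≈-trans (π · f i) (π · x) (f j) (·-cong π (f i) x (≈-sym x (f i) x≈fi)) πx≈fj)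

moves-index : ∀ {X : V ℓ} π → π · X ≈ X → ∀ i → ∃[ j ] π · element X i ≈ element X j
moves-index {X = set _} π (f , _) = f

module Orbits (em : ∀ {a} → ExcludedMiddle a) {ℓ} (X : V ℓ)
              (supported : ∀ i → FinitelySupported (element X i)) (A : List ℚ)
              (invariant : ∀ π → π FixesAll A → π · X ≈ X)
              (finite : FinitelyManyOrbits (λ π x y → π · x ≈ y) A (_∈ X)) where

  private
    I = Index X
    el = element X

  infix 4 _~_

  _~_ : I → I → Set ℓ
  i ~ j = ∃[ π ] π FixesAll A × π · el i ≈ el j

  ~-sym : ∀ {i j} → i ~ j → j ~ i
  ~-sym (π , fix , eq) = π ⁻¹ , fixesAll-⁻¹ π A fix , ·-⁻¹ π eq

  ~-trans : ∀ {i j k} → i ~ j → j ~ k → i ~ k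
  ~-trans (π , π-fix , π-eq) (σ , σ-fix , σ-eq) =
    σ ∘ᴬ π , fixesAll-∘ {σ} {π} σ-fix π-fix , ·-trans σ π (σ ∘ᴬ π) (λ _ → refl) π-eq σ-eq

  -- The list that witnesses finiteness may meet an orbit repeatedly. Repetitions are removed so
  -- that the orbit index of a cell is determined by any of its points.
  transversal : ∃[ n ] Σ[ rep ∈ (Fin n → I) ]
    (∀ i → ∃[ o ] rep o ~ i) × (∀ o o′ → rep o ~ rep o′ → o ≡ o′)
  transversal =
    let xs , xs∈X , covers = finite
        n , rep , complete , unique = choose xs xs∈X
    in n , rep , (λ i → complete i (Any.map (λ (π , fix , eq) → π , fixes⇒fixesAll {π} fix , eq)
         (covers (el i) (i , ≈-refl (el i))))) , unique
    where
    choose : ∀ xs → All (_∈ X) xs → ∃[ n ] Σ[ rep ∈ (Fin n → I) ]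
      (∀ i → Any (λ x → ∃[ π ] π FixesAll A × π · x ≈ el i) xs → ∃[ o ] rep o ~ i) ×
      (∀ o o′ → rep o ~ rep o′ → o ≡ o′)
    choose [] [] = 0 , (λ ()) , (λ _ ()) , λ ()
    choose (x ∷ xs) ((k , x≈k) ∷ xs∈X) = extend-by (choose xs xs∈X) em
      where
      k~ : ∀ {i} → (∃[ π ] π FixesAll A × π · x ≈ el i) → k ~ i
      k~ {i} (π , fix , eq) = π , fix ,
        ≈-trans (π · el k) (π · x) (el i) (·-cong π (el k) x (≈-sym x (el k) x≈k)) eq

      extend-by : (t : ∃[ n ] Σ[ rep ∈ (Fin n → I) ]
        (∀ i → Any (λ x → ∃[ π ] π FixesAll A × π · x ≈ el i) xs → ∃[ o ] rep o ~ i) ×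
        (∀ o o′ → rep o ~ rep o′ → o ≡ o′)) →
        Dec (∃[ o ] proj₁ (proj₂ t) o ~ k) → _
      extend-by (n , rep , complete , unique) (yes (o , o~k)) = n , rep ,
        (λ { i (here eq) → o , ~-trans o~k (k~ eq) ; i (there m) → complete i m }) , unique
      extend-by (n , rep , complete , unique) (no none) = suc n , k Vector.∷ rep ,
        (λ { i (here eq) → zero , k~ eq
           ; i (there m) → let o , o~i = complete i m in suc o , o~i }) ,
        λ { zero zero _ → refl
          ; zero (suc o) k~o → contradiction (o , ~-sym k~o) none
          ; (suc o) zero o~k → contradiction (o , o~k) none
          ; (suc o) (suc o′) o~o′ → ≡.cong suc (unique o o′ o~o′) }

  orbits : ℕ
  orbits = proj₁ transversal

  rep : Fin orbits → I
  rep = proj₁ (proj₂ transversal)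

  orbit : ∀ i → ∃[ o ] rep o ~ i
  orbit = proj₁ (proj₂ (proj₂ transversal))

  orbit-unique : ∀ {o o′} → rep o ~ rep o′ → o ≡ o′
  orbit-unique = proj₂ (proj₂ (proj₂ transversal)) _ _

  support : ∀ o → IrredundantSupport A (el (rep o))
  support o = irredundantSupport em A (el (rep o)) (supported (rep o))

  module _ (o : Fin orbits) where
    open IrredundantSupport (support o) public using () renaming (size to dim; param to base)

  -- el i = π · el (rep o) has the coordinates π (base o j), and a cell of the orbit o
  -- is cut out by one literal for each coordinate.
  Cell : Set
  Cell = Σ[ o ∈ Fin orbits ] Vector Literal (dim o)

  ⟦_⟧ : Cell → Pred I ℓ
  ⟦ o , v ⟧ i = ∃[ π ] π FixesAll A × π · el (rep o) ≈ el i × (∀ j → π ⟨$⟩ base o j ⊨ v j)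

  -- Two automorphisms over `A` leading from `rep o` to `i` differ by one that stabilises
  -- `el (rep o)`, and this fixes the support pointwise. So the coordinates belong to the point, and
  -- the choice of `π` in a cell membership is immaterial.
  coordinates-unique : ∀ {o i} π σ → π FixesAll A → σ FixesAll A →
    π · el (rep o) ≈ el i → σ · el (rep o) ≈ el i → ∀ j → π ⟨$⟩ base o j ≡ σ ⟨$⟩ base o j
  coordinates-unique {o} π σ π-fix σ-fix π-eq σ-eq j = ≡.trans (≡.sym (to-from σ _))
    (≡.cong (Aut.to σ) (stabiliser-fixes (support o) (σ ⁻¹ ∘ᴬ π)
      (fixesAll-∘ {σ ⁻¹} {π} (fixesAll-⁻¹ σ A σ-fix) π-fix)
      (·-trans (σ ⁻¹) π (σ ⁻¹ ∘ᴬ π) (λ _ → refl) π-eq (·-⁻¹ σ σ-eq)) j))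

  cell-sat : ∀ {o v i} π → π FixesAll A → π · el (rep o) ≈ el i → ⟦ o , v ⟧ i →
             ∀ j → π ⟨$⟩ base o j ⊨ v j
  cell-sat {v = v} π π-fix π-eq (σ , σ-fix , σ-eq , sat) j =
    ≡.subst (_⊨ v j) (coordinates-unique σ π σ-fix π-fix σ-eq π-eq j) (sat j)

  same-orbit : ∀ {o o′ v v′ i} → ⟦ o , v ⟧ i → ⟦ o′ , v′ ⟧ i → o ≡ o′
  same-orbit (π , π-fix , π-eq , _) (σ , σ-fix , σ-eq , _) =
    orbit-unique (~-trans (π , (λ {x} → π-fix) , π-eq) (~-sym (σ , (λ {x} → σ-fix) , σ-eq)))

  ∩-closed : ∀ a b i → ⟦ a ⟧ i → ⟦ b ⟧ i →
             ∃[ d ] (⟦ d ⟧ ⊆ ⟦ a ⟧ ∩ ⟦ b ⟧) × (⟦ a ⟧ ∩ ⟦ b ⟧ ⊆ ⟦ d ⟧)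
  ∩-closed (o , v) (o′ , v′) i ma mb with same-orbit {v = v} {v′ = v′} ma mb
  ... | refl =
    let π , π-fix , π-eq , sat = ma
        both : ∀ j → _
        both j = meet (v j) (v′ j) (sat j) (cell-sat {v = v′} π π-fix π-eq mb j)
    in (o , λ j → proj₁ (both j)) ,
       (λ (σ , σ-fix , σ-eq , sat) →
         (σ , σ-fix , σ-eq , λ j → proj₁ (proj₁ (proj₂ (both j) _) (sat j))) ,
         (σ , σ-fix , σ-eq , λ j → proj₂ (proj₁ (proj₂ (both j) _) (sat j)))) ,
       λ ((σ , σ-fix , σ-eq , sat) , mb′) → σ , σ-fix , σ-eq , λ j →
         proj₂ (proj₂ (both j) _) (sat j , cell-sat {v = v′} σ σ-fix σ-eq mb′ j)

  cell-resp : ∀ {o v w i} → (∀ j → v j ≡ w j) → ⟦ o , v ⟧ i → ⟦ o , w ⟧ i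
  cell-resp eq (π , fix , π-eq , sat) =
    π , fix , π-eq , λ j → ≡.subst (_ ⊨_) (eq j) (sat j)

  infixr 8 _•_

  _•_ : Aut → ∀ {n} → Vector Literal n → Vector Literal n
  (π • v) j = mapᴸ π (v j)

  cell-translate : ∀ {o v i j} π → π FixesAll A → π · el i ≈ el j →
                   ⟦ o , v ⟧ i → ⟦ o , π • v ⟧ j
  cell-translate {v = v} π fix eq (σ , σ-fix , σ-eq , sat) =
    π ∘ᴬ σ , fixesAll-∘ {π} {σ} fix σ-fix , ·-trans π σ (π ∘ᴬ σ) (λ _ → refl) σ-eq eq ,
    λ l → ⊨-map π (v l) (sat l)

  cell-translate⁻ : ∀ {o v i j} π → π FixesAll A → π · el i ≈ el j →
                    ⟦ o , π • v ⟧ j → ⟦ o , v ⟧ i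
  cell-translate⁻ {v = v} π fix eq m = cell-resp (λ l → mapᴸ-⁻¹ π (v l))
    (cell-translate (π ⁻¹) (fixesAll-⁻¹ π A fix) (·-⁻¹ π eq) m)

  -- Generic points

  module _ (o : Fin orbits) (v : Vector Literal (dim o)) where

    -- Points of the cell are handled through the automorphisms that produce them, because joins
    -- exist for automorphisms.
    record Realises (π : Aut) : Set where
      constructor _,_
      field
        fixesA  : π FixesAll A
        sat     : ∀ j → π ⟨$⟩ base o j ⊨ v j

    open Realises

    -- Each coordinate of the join is a coordinate of `π` or of `σ`, so a condition on single
    -- coordinates is inherited.
    ⊔-realises : ∀ {π σ} → Realises π → Realises σ → Realises (π ⊔ᴬ σ)
    ⊔-realises {π} {σ} r s = fixes , λ j → ≡.subst (_⊨ v j) (≡.sym (⊔ᴬ-to π σ (base o j))) (either j)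
      where
      fixes : (π ⊔ᴬ σ) FixesAll A
      fixes {x} m = ≡.trans (⊔ᴬ-to π σ x) (≡.trans (≡.cong₂ ℚ._⊔_ (fixesA r m) (fixesA s m)) (ℚ.⊔-idem x))

      either : ∀ j → (π ⟨$⟩ base o j) ℚ.⊔ (σ ⟨$⟩ base o j) ⊨ v j
      either j with ℚ.⊔-sel (π ⟨$⟩ base o j) (σ ⟨$⟩ base o j)
      ... | inj₁ eq = ≡.subst (_⊨ v j) (≡.sym eq) (sat r j)
      ... | inj₂ eq = ≡.subst (_⊨ v j) (≡.sym eq) (sat s j)

    -- The values of `base o` under `π` are distinct and outside `A`, so one of them can be nudged
    -- upwards while `A` and the others stay fixed.
    raise : ∀ {π} → Realises π → ∀ j {u} → π ⟨$⟩ base o j < u → (∀ {q} → q < u → q ⊨ v j) →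
            ∃[ σ ] Realises σ × π ⟨$⟩ base o j < σ ⟨$⟩ base o j
    raise {π} r j {u} lt room =
      let σ , lo , hi , σ-fix = nudge lt (A ++ tabulate (Aut.to π ∘ base o))
      in σ ∘ᴬ π , ((λ m → ≡.trans (≡.cong (Aut.to σ) (fixesA r m)) (σ-fix (∈-++⁺ˡ m) (apart m))) ,
           λ i → moved σ hi (λ i≢j → σ-fix (∈-++⁺ʳ A (∈-tabulate⁺ i))
             (param-distinct (support o) i≢j ∘ to-injective π)) (i ≟ᶠ j)) , lo
      where
      apart : ∀ {x} → x ∈ₗ A → x ≢ π ⟨$⟩ base o j
      apart m eq = param∉ (support o) j (≡.subst (_∈ₗ A)
        (to-injective π (≡.trans (fixesA r m) eq)) m)

      moved : ∀ {i} σ → σ ⟨$⟩ π ⟨$⟩ base o j < u →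
              (i ≢ j → σ ⟨$⟩ π ⟨$⟩ base o i ≡ π ⟨$⟩ base o i) → Dec (i ≡ j) →
              σ ⟨$⟩ π ⟨$⟩ base o i ⊨ v i
      moved σ hi fix (yes refl) = room hi
      moved {i} σ hi fix (no i≢j) = ≡.subst (_⊨ v i) (≡.sym (fix i≢j)) (sat r i)

    -- Avoidance is required of every realisation above `π`, so that finitely many such demands are
    -- met together above a join.
    EventuallyOutside : Cell → Set ℓ
    EventuallyOutside b = ∃[ π ] Realises π × (∀ σ → Realises σ →
      (∀ j → π ⟨$⟩ base o j ≤ σ ⟨$⟩ base o j) → ∀ i → σ · el (rep o) ≈ el i → ¬ ⟦ b ⟧ i)

    -- A coordinate not pinned by v has no maximum on the cell, so a failing literal
    -- keeps failing above some point of the cell.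
    eventually-outside : ∀ {b i} → ⟦ o , v ⟧ i → ¬ ⟦ b ⟧ i → EventuallyOutside b
    eventually-outside {o′ , v′} {i} (π , fix , eq , sat) ¬b with em {P = o ≡ o′}
    ... | no o≢o′ = π , (fix , sat) , λ σ r _ i′ σ-eq mb →
      o≢o′ (same-orbit {v = v} {v′ = v′} (σ , fixesA r , σ-eq , Realises.sat r) mb)
    ... | yes refl with em {P = ∃[ j ] ¬ (π ⟨$⟩ base o j ⊨ v′ j)}
    ...   | no none = contradiction (π , fix , eq , λ j → stable j em) ¬b
      where
      stable : ∀ j → Dec (π ⟨$⟩ base o j ⊨ v′ j) → π ⟨$⟩ base o j ⊨ v′ j
      stable j (yes s) = s
      stable j (no ¬s) = contradiction (j , ¬s) none
    ...   | yes (j , ¬s) = outside (v′ j) refl ¬s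
      where
      r₀ : Realises π
      r₀ = fix , sat

      escape : ∀ ρ → Realises ρ →
        (∀ σ → Realises σ → ρ ⟨$⟩ base o j ≤ σ ⟨$⟩ base o j → ¬ (σ ⟨$⟩ base o j ⊨ v′ j)) →
        EventuallyOutside (o , v′)
      escape ρ r fails = ρ , r , λ σ s above i′ σ-eq mb →
        fails σ s (above j) (cell-sat {v = v′} σ (fixesA s) σ-eq mb j)

      no-maximum : ∀ {p} → (∀ {ρ} → Realises ρ → ∃[ u ] ρ ⟨$⟩ base o j < u × (∀ {q} → q < u → q ⊨ v j)) →
                   (∀ ρ → Realises ρ → ¬ (p < ρ ⟨$⟩ base o j)) →
                   ∀ ρ → Realises ρ → ρ ⟨$⟩ base o j ≢ p
      no-maximum room bounded ρ r refl =
        let u , lt , free-below = room r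
            σ , s , up = raise r j lt free-below
        in bounded σ s up

      outside : ∀ l → v′ j ≡ l → ¬ (π ⟨$⟩ base o j ⊨ l) → EventuallyOutside (o , v′)
      outside free eq′ ¬s = contradiction tt ¬s
      outside (below p) eq′ ¬s = escape π r₀ λ σ s le m →
        ¬s (≤-<-trans le (≡.subst (_ ⊨_) eq′ m))
      -- Above a realisation exceeding `p`, the value `p` is out of reach. If none exceeds `p`, then
      -- `p` could be attained only as a maximum, which `raise` rules out unless `v j` is some
      -- `at q`; in that case every realisation has the same coordinate as `π`, which is not `p`.
      outside (at p) eq′ ¬s with em {P = ∃[ ρ ] Realises ρ × p < ρ ⟨$⟩ base o j}
      ... | yes (ρ , r , p<ρ) = escape ρ r λ σ s le m →
        <-irrefl (≡.sym (≡.subst (_ ⊨_) eq′ m)) (<-≤-trans p<ρ le)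
      ... | no none = escape π r₀ λ σ s le m →
        avoids (v j) refl σ s (≡.subst (_ ⊨_) eq′ m)
        where
        bounded : ∀ ρ → Realises ρ → ¬ (p < ρ ⟨$⟩ base o j)
        bounded ρ r lt = none (ρ , r , lt)

        avoids : ∀ l → v j ≡ l → ∀ ρ → Realises ρ → ρ ⟨$⟩ base o j ≢ p
        avoids free eq″ = no-maximum (λ {ρ} r →
          let u , lt , _ = gap-above (ρ ⟨$⟩ base o j) []
          in u , lt , λ _ → ≡.subst (_ ⊨_) (≡.sym eq″) tt) bounded
        avoids (below u) eq″ = no-maximum (λ {ρ} r →
          u , ≡.subst (_ ⊨_) eq″ (Realises.sat r j) , λ lt → ≡.subst (_ ⊨_) (≡.sym eq″) lt) bounded
        avoids (at q) eq″ ρ r ρ≡p = ¬s (≡.trans (≡.subst (_ ⊨_) eq″ (sat j))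
          (≡.trans (≡.sym (≡.subst (_ ⊨_) eq″ (Realises.sat r j))) ρ≡p))

    -- A cell that contains `⟦ o , v ⟧` imposes nothing, any other one supplies a bound from
    -- `eventually-outside`, and the bounds are combined by joins.
    eventually-generic : ∀ {i} → ⟦ o , v ⟧ i → ∀ n (b : Fin n → Cell) →
      ∃[ π ] Realises π × (∀ σ → Realises σ → (∀ j → π ⟨$⟩ base o j ≤ σ ⟨$⟩ base o j) →
        ∀ i → σ · el (rep o) ≈ el i → ∀ l → ⟦ b l ⟧ i → ⟦ o , v ⟧ ⊆ ⟦ b l ⟧)
    eventually-generic (π , fix , _ , sat) zero b = π , (fix , sat) , λ _ _ _ _ _ ()
    eventually-generic {i} m (suc n) b =
      let π , r , tail-generic = eventually-generic m n (b ∘ suc)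
          σ , s , head-generic = single em
      in π ⊔ᴬ σ , ⊔-realises r s , λ ρ t above i′ eq → λ
           { zero mb → head-generic ρ t (λ j → ≤-trans (ℚ.p≤q⊔p (π ⟨$⟩ base o j) (σ ⟨$⟩ base o j)) (≡.subst (_≤ _) (⊔ᴬ-to π σ _) (above j))) i′ eq mb
           ; (suc l) mb → tail-generic ρ t (λ j → ≤-trans (ℚ.p≤p⊔q (π ⟨$⟩ base o j) (σ ⟨$⟩ base o j)) (≡.subst (_≤ _) (⊔ᴬ-to π σ _) (above j))) i′ eq l mb }
      where
      single : Dec (∃[ i ] ⟦ o , v ⟧ i × ¬ ⟦ b zero ⟧ i) →
        ∃[ π ] Realises π × (∀ σ → Realises σ → (∀ j → π ⟨$⟩ base o j ≤ σ ⟨$⟩ base o j) →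
          ∀ i → σ · el (rep o) ≈ el i → ⟦ b zero ⟧ i → ⟦ o , v ⟧ ⊆ ⟦ b zero ⟧)
      single (yes (i , ma , ¬mb)) =
        let π , r , out = eventually-outside {b zero} ma ¬mb
        in π , r , λ σ s above i′ eq mb → contradiction mb (out σ s above i′ eq)
      single (no none) = let π , fix , _ , sat = m in π , (fix , sat) , λ _ _ _ _ _ _ {x} mx → stable mx em
        where
        stable : ∀ {x} → ⟦ o , v ⟧ x → Dec (⟦ b zero ⟧ x) → ⟦ b zero ⟧ x
        stable mx (yes mb) = mb
        stable {x} mx (no ¬mb) = contradiction (x , mx , ¬mb) none

  generic-points : ∀ a → ∃[ i ] ⟦ a ⟧ i → ∀ n (b : Fin n → Cell) →
    ∃[ i ] ⟦ a ⟧ i × (∀ l → ⟦ b l ⟧ i → ⟦ a ⟧ ⊆ ⟦ b l ⟧)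
  generic-points (o , v) (_ , m) n b =
    let π , r , generic = eventually-generic o v m n b
        i , eq = moves-index π (invariant π (Realises.fixesA r)) (rep o)
    in i , (π , Realises.fixesA r , eq , Realises.sat r) , generic π r (λ _ → ≤-refl) i eq

  -- Separation of points by finitely many cells

  literal-at : ∀ {n} → Fin n → Literal → Vector Literal n
  literal-at j l k with k ≟ᶠ j
  ... | yes _ = l
  ... | no _  = free

  literal-at-≡ : ∀ {n} (j : Fin n) l → literal-at j l j ≡ l
  literal-at-≡ j l with j ≟ᶠ j
  ... | yes _ = refl
  ... | no j≢j = contradiction refl j≢j

  literal-at-sat : ∀ {n} (j : Fin n) l (q : Fin n → ℚ) → q j ⊨ l → ∀ k → q k ⊨ literal-at j l k
  literal-at-sat j l q s k with k ≟ᶠ j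
  ... | yes refl = s
  ... | no _ = tt

  whole : Fin orbits → Cell
  whole o = o , λ _ → free

  -- Atomic conditions with parameters in `P`, not atoms of the set theory. The cells `whole o` tell
  -- the orbits apart and cover `X`.
  atoms : List ℚ → List Cell
  atoms P = concatMap (λ o → whole o ∷ concatMap (λ j → concatMap (λ p →
    (o , literal-at j (below p)) ∷ (o , literal-at j (at p)) ∷ []) P) (allFin (dim o))) (allFin orbits)

  module _ (P : List ℚ) where

    whole∈atoms : ∀ o → whole o ∈ₗ atoms P
    whole∈atoms o = ∈-concatMap⁺ _ (lose (∈-allFin o) (here refl))

    private
      literal∈atoms : ∀ o j {p} → p ∈ₗ P → ∀ {a} →
        a ∈ₗ (o , literal-at j (below p)) ∷ (o , literal-at j (at p)) ∷ [] → a ∈ₗ atoms P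
      literal∈atoms o j p∈P m = ∈-concatMap⁺ _ (lose (∈-allFin o) (there
        (∈-concatMap⁺ _ (lose (∈-allFin j) (∈-concatMap⁺ _ (lose p∈P m))))))

    below∈atoms : ∀ o j {p} → p ∈ₗ P → (o , literal-at j (below p)) ∈ₗ atoms P
    below∈atoms o j p∈P = literal∈atoms o j p∈P (here refl)

    at∈atoms : ∀ o j {p} → p ∈ₗ P → (o , literal-at j (at p)) ∈ₗ atoms P
    at∈atoms o j p∈P = literal∈atoms o j p∈P (there (here refl))

    atoms-cover : ∀ i → Any (λ a → ⟦ a ⟧ i) (atoms P)
    atoms-cover i = let o , (π , fix , eq) = orbit i in
      lose (whole∈atoms o) (π , (λ {x} → fix) , eq , λ _ → tt)

  -- Agreement on `atoms P` puts the two points in one orbit, with coordinates having equal cuts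
  -- over `P`. Homogeneity matches the coordinates by some `σ` fixing `P`, and over `A` the
  -- coordinates determine the point.
  atoms-separate : ∀ P → (∀ {a} → a ∈ₗ A → a ∈ₗ P) → ∀ i i′ →
    All (λ a → (⟦ a ⟧ i → ⟦ a ⟧ i′) × (⟦ a ⟧ i′ → ⟦ a ⟧ i)) (atoms P) →
    ∃[ σ ] σ FixesAll P × σ · el i ≈ el i′
  atoms-separate P A⊆P i i′ same =
    let o , (π , π-fix , π-eq) = orbit i
        π′ , π′-fix , π′-eq , _ = proj₁ (All.lookup same (whole∈atoms P o)) (π , (λ {x} → π-fix) , π-eq , λ _ → tt)
    in connect o π π-fix π-eq π′ π′-fix π′-eq
    where
    module _ (o : Fin orbits) (π : Aut) (π-fix : π FixesAll A) (π-eq : π · el (rep o) ≈ el i)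
             (π′ : Aut) (π′-fix : π′ FixesAll A) (π′-eq : π′ · el (rep o) ≈ el i′) where

      forth : ∀ j l → (o , literal-at j l) ∈ₗ atoms P → π ⟨$⟩ base o j ⊨ l → π′ ⟨$⟩ base o j ⊨ l
      forth j l m s = ≡.subst (_ ⊨_) (literal-at-≡ j l) (cell-sat {v = literal-at j l} π′ π′-fix π′-eq
        (proj₁ (All.lookup same m) (π , π-fix , π-eq , literal-at-sat j l (λ k → π ⟨$⟩ base o k) s)) j)

      back : ∀ j l → (o , literal-at j l) ∈ₗ atoms P → π′ ⟨$⟩ base o j ⊨ l → π ⟨$⟩ base o j ⊨ l
      back j l m s = ≡.subst (_ ⊨_) (literal-at-≡ j l) (cell-sat {v = literal-at j l} π π-fix π-eq
        (proj₂ (All.lookup same m) (π′ , π′-fix , π′-eq , literal-at-sat j l (λ k → π′ ⟨$⟩ base o k) s)) j)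

      cut : ∀ j → SameCut (π ⟨$⟩ base o j) (π′ ⟨$⟩ base o j) P
      cut j {p} m =
        forth j (below p) (below∈atoms P o j m) ,
        -- No cell expresses `p < t`; it is recovered by trichotomy from the failure of `at p` and
        -- `below p`, which transfers through `back`.
        (λ p<πj → above p<πj (<-cmp p (π′ ⟨$⟩ base o j))) ,
        forth j (at p) (at∈atoms P o j m)
        where
        above : p < π ⟨$⟩ base o j → Tri (p < π′ ⟨$⟩ base o j) (p ≡ π′ ⟨$⟩ base o j) (π′ ⟨$⟩ base o j < p) →
                p < π′ ⟨$⟩ base o j
        above p<πj (tri< lt _ _) = lt
        above p<πj (tri≈ _ eq _) = contradiction p<πj
          (<-irrefl (≡.sym (back j (at p) (at∈atoms P o j m) (≡.sym eq))))
        above p<πj (tri> _ _ gt) = contradiction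
          (<-trans p<πj (back j (below p) (below∈atoms P o j m) gt)) (<-irrefl refl)

      connect : ∃[ σ ] σ FixesAll P × σ · el i ≈ el i′
      connect =
        let σ , σ-fix , σ-eq = homogeneous P (dim o) (λ j → π ⟨$⟩ base o j) (λ j → π′ ⟨$⟩ base o j) cut
              (λ j k lt → to-mono-< π′ (to-cancel-< π lt))
              (λ j k eq → ≡.cong (Aut.to π′) (to-injective π eq))
            -- Fixing `A` and the support, `κ` fixes `el (rep o)`; writing `σ` as `π′ ∘ᴬ κ ∘ᴬ π ⁻¹`
            -- then takes `el i` to `el i′`.
            κ = π′ ⁻¹ ∘ᴬ σ ∘ᴬ π
            κ-eq : κ · el (rep o) ≈ el (rep o)
            κ-eq = IrredundantSupport.supports (support o) κ
              (λ m → from-eq π′ (≡.trans (π′-fix m) (≡.sym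
                (≡.trans (≡.cong (Aut.to σ) (π-fix m)) (σ-fix (A⊆P m))))))
              (λ j → from-eq π′ (≡.sym (σ-eq j)))
        in σ , (λ {x} → σ-fix) ,
           ·-trans (π′ ∘ᴬ κ) (π ⁻¹) σ
             (λ q → ≡.trans (to-from π′ _) (≡.cong (Aut.to σ) (to-from π q)))
             (·-⁻¹ π π-eq) (·-trans π′ κ (π′ ∘ᴬ κ) (λ _ → refl) κ-eq π′-eq)

-- The basis

module Basis (em : ∀ {a} → ExcludedMiddle a) {ℓ c e} (X : V ℓ)
             (hfs : HereditarilyFinitelySupported X)
             (K : Field c e) (A : List ℚ) (invariant : ∀ π → π FixesAll A → π · X ≈ X)
             (finite : FinitelyManyOrbits (λ π x y → π · x ≈ y) A (_∈ X)) where

  private module K = Field K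
  open K using (Carrier; 0#; 1#) renaming (_≈ᴷ_ to _≋_)
  open FinSuppFunc using (to)
  open Orbits em X (element-finitelySupported hfs) A invariant finite
  open Indicators em K ⟦_⟧

  -- A property of the function, not the image of `cell-function`: it is closed under pointwise
  -- equality, and a cell with several descriptions counts once. `Lift` only adjusts the level.
  B : Pred (FinSuppFunc K X) (ℓ ⊔ c ⊔ e)
  B f = Lift c (∃[ a ] (∃[ i ] ⟦ a ⟧ i) × IsIndicator ⟦ a ⟧ (to f))

  indicators-agree : ∀ {p q} {P : Pred (Index X) p} {Q : Pred (Index X) q} {f g i j} →
    IsIndicator P f → IsIndicator Q g → (P i → Q j) → (Q j → P i) → f i ≋ g j
  indicators-agree {P = P} {i = i} {j} P-ind Q-ind f⇒ f⇐ with em {P = P i}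
  ... | yes p = K.trans (proj₁ (P-ind i) p) (K.sym (proj₁ (Q-ind j) (f⇒ p)))
  ... | no ¬p = K.trans (proj₂ (P-ind i) ¬p) (K.sym (proj₂ (Q-ind j) (¬p ∘ f⇐)))

  characteristic : ∀ {p} → Pred (Index X) p → Index X → Carrier
  characteristic P = restrict (λ _ → 1#) P

  characteristic-indicator : ∀ {p} (P : Pred (Index X) p) → IsIndicator P (characteristic P)
  characteristic-indicator P i = restrict-∈ (λ _ → 1#) P , restrict-∉ (λ _ → 1#) P

  cell-function : Cell → FinSuppFunc K X
  cell-function (o , v) = record
    { func = record
      { to = characteristic ⟦ o , v ⟧
      ; cong = λ {i} {j} i≈j → indicators-agree (ind ⟦ o , v ⟧) (ind ⟦ o , v ⟧)
          (cell-≈ i j i≈j) (cell-≈ j i (≈-sym _ _ i≈j))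
      }
    ; support = A ++ concatMap (parameters ∘ v) (allFin (dim o)) , λ π fixes →
        let fix = fixes⇒fixesAll {π} fixes
            fixA : π FixesAll A
            fixA = λ m → fix (∈-++⁺ˡ m)
            fix-v : ∀ k → mapᴸ π (v k) ≡ v k
            fix-v = λ k → mapᴸ-fixed (v k) λ m →
              fix (∈-++⁺ʳ A (∈-concatMap⁺ (parameters ∘ v) (lose (∈-allFin k) m)))
        in invariant π fixA , λ i j eq → indicators-agree (ind ⟦ o , v ⟧) (ind ⟦ o , v ⟧)
          (λ m → cell-resp fix-v (cell-translate π fixA eq m))
          (λ m → cell-translate⁻ π fixA eq (cell-resp (≡.sym ∘ fix-v) m))
    }
    where
    ind = characteristic-indicator

    cell-≈ : ∀ i j → element X i ≈ element X j → ⟦ o , v ⟧ i → ⟦ o , v ⟧ j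
    cell-≈ i j i≈j (π , fix , eq , sat) = π , (λ {x} → fix) , ≈-trans _ _ _ eq i≈j , sat

  cell-function-∈ : ∀ a → ∃[ i ] ⟦ a ⟧ i → B (cell-function a)
  cell-function-∈ a inhabited = lift (a , inhabited , characteristic-indicator ⟦ a ⟧)

  open Spanning {T = ∃ B} (to ∘ proj₁)
    (λ a inhabited → (cell-function a , cell-function-∈ a inhabited) , characteristic-indicator ⟦ a ⟧)
    ∩-closed

  private
    𝕍 = K ^ record { value = X ; hereditary = hfs }
    module ΣK = Sum K.+-commutativeMonoid

  combination-at : ∀ n (k : Vector Carrier n) b i →
    to (combination 𝕍 k b) i ≋ ΣK.sum (λ j → k j K.* to (b j) i)
  combination-at zero    k b i = K.refl
  combination-at (suc n) k b i = K.+-congˡ (combination-at n (k ∘ suc) (b ∘ suc) i)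

  linearlyIndependent : LinearlyIndependent 𝕍 B
  linearlyIndependent n k b b∈B distinct zero-sum =
    indicators-independent generic-points n k (to ∘ b) (λ j → proj₁ (lower (b∈B j)))
      (λ j → proj₁ (proj₂ (lower (b∈B j)))) (λ j → proj₂ (proj₂ (lower (b∈B j)))) distinct
      (λ i → K.trans (K.sym (combination-at n k b i)) (zero-sum i))

  inSpan⇒combination : ∀ {h} → InSpan h → ∃[ n ] ∃[ k ] ∃[ b ]
    (∀ (j : Fin n) → B (b j)) × (∀ i → h i ≋ to (combination 𝕍 k b) i)
  inSpan⇒combination (nil z) = 0 , (λ ()) , (λ ()) , (λ ()) , z
  inSpan⇒combination (cons k (f , f∈B) s eq) =
    let n , ks , b , b∈B , z = inSpan⇒combination s
    in suc n , k Vector.∷ ks , f Vector.∷ b , (λ { zero → f∈B ; (suc j) → b∈B j }) ,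
       λ i → K.trans (eq i) (K.+-congˡ (z i))

  spans : Spans 𝕍 B
  spans f = inSpan⇒combination (span-all (atoms P) (to f) determined (atoms-cover P))
    where
    P = A ++ proj₁ (FinSuppFunc.support f)

    -- `P` contains the support of `f`, so the automorphism joining two inseparable points leaves
    -- `f` unchanged and forces equal values there.
    determined : DeterminedOn (λ _ → ⊤) (atoms P) (to f)
    determined i j same _ _ =
      let σ , fix , eq = atoms-separate P ∈-++⁺ˡ i j same
      in proj₂ (proj₂ (FinSuppFunc.support f) σ (fixesAll⇒fixes {σ} λ m → fix (∈-++⁺ʳ A m))) i j eq

  isBasis : IsBasis 𝕍 B
  isBasis = record
    { respects = λ { f≈g (lift (a , inhabited , ind)) → lift (a , inhabited , λ i →
        (λ m → K.trans (K.sym (f≈g i)) (proj₁ (ind i) m)) ,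
        (λ ¬m → K.trans (K.sym (f≈g i)) (proj₂ (ind i) ¬m))) }
    ; linearlyIndependent = linearlyIndependent
    ; spans = spans
    }

  translate : ∀ f g {o} {v w : Vector Literal (dim o)} π → π FixesAll A →
    (∀ k → mapᴸ π (v k) ≡ w k) → IsIndicator ⟦ o , v ⟧ (to f) → IsIndicator ⟦ o , w ⟧ (to g) →
    TranslateFS K X π f g
  translate f g π fix eq f-ind g-ind = invariant π fix , λ i j π-eq → indicators-agree f-ind g-ind
    (λ m → cell-resp eq (cell-translate π fix π-eq m))
    (λ m → cell-translate⁻ π fix π-eq (cell-resp (≡.sym ∘ eq) m))

  translate-inhabited : ∀ {o v} π → π FixesAll A → ∃[ i ] ⟦ o , v ⟧ i → ∃[ i ] ⟦ o , π • v ⟧ i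
  translate-inhabited π fix (i , m) =
    let j , eq = moves-index π (invariant π fix) i in j , cell-translate π fix eq m

  definable : DefinableSubset (TranslateFS K X) B
  definable = A , supports , orbits-finite
    where
    supports : SupportsSubset (TranslateFS K X) A B
    supports π fixes =
      let fix = fixes⇒fixesAll {π} fixes
          fix⁻¹ = fixesAll-⁻¹ π A fix
      in (λ { f (lift ((o , v) , inhabited , ind)) →
              cell-function (o , π • v) ,
              cell-function-∈ (o , π • v) (translate-inhabited π fix inhabited) ,
              translate f (cell-function (o , π • v)) π fix (λ _ → refl) ind (characteristic-indicator ⟦ o , π • v ⟧) }) ,
         (λ { g (lift ((o , v) , inhabited , ind)) →
              cell-function (o , π ⁻¹ • v) ,
              cell-function-∈ (o , π ⁻¹ • v) (translate-inhabited (π ⁻¹) fix⁻¹ inhabited) ,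
              translate (cell-function (o , π ⁻¹ • v)) g π fix (λ k → mapᴸ-⁻¹′ π (v k)) (characteristic-indicator ⟦ o , π ⁻¹ • v ⟧) ind })

    -- A class collects the indicators whose literals can be brought to the normal form `r` over
    -- `A`. Two members are translates of each other through `r`. Some `r` describe empty cells, so
    -- a class may have no member in `B`.
    _∋_ : Cell → Pred (FinSuppFunc K X) _
    (o , r) ∋ f = ∃[ v ] IsIndicator ⟦ o , v ⟧ (to f) ×
                  (∃[ σ ] σ FixesAll A × (∀ k → mapᴸ σ (v k) ≡ r k))

    same-class : ∀ {r} f g → r ∋ f → r ∋ g → ∃[ π ] Fixes π A × TranslateFS K X π f g
    same-class f g (v , f-ind , σ , σ-fix , σ-eq) (w , g-ind , τ , τ-fix , τ-eq) =
      τ ⁻¹ ∘ᴬ σ , fixesAll⇒fixes {τ ⁻¹ ∘ᴬ σ} fix , translate f g (τ ⁻¹ ∘ᴬ σ) fix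
        (λ k → ≡.trans (≡.sym (mapᴸ-∘ (τ ⁻¹) σ (v k)))
          (≡.trans (≡.cong (mapᴸ (τ ⁻¹)) (≡.trans (σ-eq k) (≡.sym (τ-eq k)))) (mapᴸ-⁻¹ τ (w k))))
        f-ind g-ind
      where
      fix : (τ ⁻¹ ∘ᴬ σ) FixesAll A
      fix = fixesAll-∘ {τ ⁻¹} {σ} (fixesAll-⁻¹ τ A τ-fix) σ-fix

    orbits-finite : FinitelyManyOrbits (TranslateFS K X) A B
    orbits-finite =
      let fs , fs∈B , complete = representatives em B _∋_
            (concatMap (λ o → map (o ,_) (proj₁ (literal-representatives em (dim o) A))) (allFin orbits))
            λ { f (lift ((o , v) , _ , ind)) → concatMap⁺ _ (lose (∈-allFin o) (map⁺
              (Any.map (λ conjugate → v , ind , conjugate)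
                (proj₂ (literal-representatives em (dim o) A) v)))) }
      in fs , fs∈B , λ g g∈B → Any.map (λ {f} (_ , r∋f , r∋g) → same-class f g r∋f r∋g) (complete g g∈B)

mainTheorem11 : (∀ {a} → ExcludedMiddle a) →
    ∀ {ℓ c e} (X : ZFAℚ ℓ) → Definable (ZFAℚ.value X) →
    (K : Field c e) →
    Σ[ B ∈ Pred (FinSuppFunc K (ZFAℚ.value X)) (ℓ ⊔ c ⊔ e) ]
    IsBasis (K ^ X) B ×
    DefinableSubset (TranslateFS K (ZFAℚ.value X)) B
mainTheorem11 em record { value = X ; hereditary = hfs } (isSet , A , supp , finite) K = B , isBasis , definable
  where open Basis em X hfs K A (supportsMembers⇒invariant isSet supp) finite
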